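{- Let $k\ge 1$ be an integer and let $A(x),B(x)$ be the generating functions of valid trees defined in the context. Then \begin{align*} A(x)&= 1+\sum_{n\ge 1}\sum_{\lambda}\frac{1}{n}\, \frac{|\lambda|}{kn+1}\binom{n}{|\lambda|}\binom{kn+1}{\ell(\lambda)}\frac{\ell(\lambda)!}{m_\lambda}\mathbf{t}^{\lambda} x^n,\\ B(x) &=1+\sum_{n\ge 1}\sum_{\lambda} \frac{1}{n} \binom{n}{|\lambda|+1}\binom{kn}{\ell(\lambda)}\frac{\ell(\lambda)!}{m_\lambda}\mathbf{t}^{\lambda} x^n,\\ A(x)B(x)&=1+\sum_{n \ge 1}\sum_{\lambda} \frac{1}{n}\left(\binom{n}{|\lambda|+1}+\frac{|\lambda|}{kn+1}\binom{n+1}{|\lambda|+1}\right)\binom{kn+1}{\ell(\lambda)}\frac{\ell(\lambda)!}{m_\lambda}\mathbf{t}^{\lambda} x^n, \end{align*} where the inner sums run over all partitions $\lambda$ (including the empty partition).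
   Context: For a partition $\lambda$, $\ell(\lambda)$ is its number of parts, $|\lambda|$ the sum of its parts, $m_i(\lambda)$ the number of parts equal to $i$, and $m_\lambda=m_1(\lambda)!\,m_2(\lambda)!\cdots$. Let $K=\mathbb{C}(t_1,t_2,t_3,\ldots)$ be the field of rational functions in (finitely many of) the indeterminates $t_i$, and $\mathbf{t}^\lambda=t_1^{m_1(\lambda)}t_2^{m_2(\lambda)}t_3^{m_3(\lambda)}\cdots\in K$. Generating functions lie in $K[[x]]$. Binomial coefficients $\binom{a}{b}$ with $b<0$ or $b>a\ge 0$ are $0$. A rooted plane tree is a rooted tree in which each vertex has a linearly ordered list of children. For $0\le j\le k$ and $n\ge 0$, a $j$-rooted $(n,k)$-valid tree is a rooted plane tree with $(k+1)n$ edges and $(k+1)n+1$ vertices, whose vertices are labeled by consecutive integers in pre-order starting with label $j$ at the root, labels being considered modulo $k+1$, such that: every vertex with label $\equiv 1\pmod{k+1}$ has either $0$ or $k+1$ children; every vertex with label $\not\equiv 1\pmod{k+1}$ has $m(k+1)$ children for some nonnegative integer $m$. Its type is the partition formed by all positive $m$ (with repetition) such that some vertex in the latter category has $m(k+1)$ children. Let $S_j$ be the set of all $j$-rooted $(n,k)$-valid trees over all $n\ge 0$, and let \[ A_j(x)=\sum_{T\in S_j}\mathbf{t}^{\lambda(T)}x^{\nu(T)}, \] where $\lambda(T)$ is the type of $T$ and $\nu(T)$ is the $n$ such that $T$ has $(k+1)n$ edges. Then $A(x)$ denotes the common power series $A_0(x)=A_2(x)=A_3(x)=\cdots=A_k(x)$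 (so $A(x)=A_0(x)$), and $B(x)=A_1(x)$. -}

module Defs where

open import Algebra.Bundles using (CommutativeRing)
open import Data.Integer.Base using (+_)
open import Data.List.Base
  using (List; []; _∷_; _++_; map; foldr; filter; length; concatMap;
         cartesianProductWith; take; upTo; applyUpTo)
open import Data.List.Membership.Propositional using (_∈_; _∉_; lose; find)
open import Data.List.Membership.Propositional.Properties
  using (∈-map⁺; ∈-map⁻; ∈-upTo⁺; ∈-upTo⁻; ∈-concatMap⁺; ∈-concatMap⁻;
         ∈-cartesianProductWith⁺; ∈-cartesianProductWith⁻)
open import Data.List.Properties using (∷-injective)
open import Data.List.Relation.Binary.Permutation.Propositional using (↭-sym)
open import Data.List.Relation.Binary.Permutation.Propositional.Properties
  using (All-resp-↭)
import Data.List.Relation.Unary.All as All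
open All using (All; []; _∷_)
open import Data.List.Relation.Unary.All.Properties as AllP
  using (all-filter)
import Data.List.Relation.Unary.AllPairs as AllPairs
open AllPairs using ([]; _∷_)
import Data.List.Relation.Unary.AllPairs.Properties as AllPairsP
open import Data.List.Relation.Unary.Any using (here)
open import Data.List.Relation.Unary.Linked using (Linked)
open import Data.List.Relation.Unary.Unique.Propositional using (Unique)
import Data.List.Relation.Unary.Unique.Propositional.Properties as UniqueP
import Data.List.Sort as Sort
open import Data.Nat.Base hiding (_⊔_; _/_; _%_)
open import Data.Nat.Combinatorics using (_C_)
open import Data.Nat.Divisibility using (_∣_; _∣?_)
open import Data.Nat.DivMod using (_/_; _%_)
open import Data.Nat.ListAction using (sum; product)
open import Data.Nat.ListAction.Properties using (product≢0)
open import Data.Nat.Properties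
open import Data.Product.Base using (_×_; _,_; proj₁; proj₂)
open import Data.Rational.Base using (ℚ)
  renaming (_+_ to _+ℚ_; _*_ to _*ℚ_; _/_ to _/ℚ_)
open import Data.Sum.Base using (_⊎_)
open import Function.Base using (_∘_)
open import Level using (_⊔_)
open import Relation.Binary.Bundles using (DecTotalOrder)
import Relation.Binary.Construct.Flip.EqAndOrd as Flip
open import Relation.Binary.PropositionalEquality
open import Relation.Nullary.Decidable using (¬?; _×-dec_; _⊎-dec_; _→-dec_)
open import Relation.Nullary.Negation using (¬_)
open import Relation.Unary using (Decidable)

-- The proof fields are irrelevant, so equality of partitions is equality
-- of their lists of parts.
record Partition : Set where
  constructor mkPartition
  field
    parts       : List ℕ
    .positive   : All (0 <_) parts
    .decreasing : Linked _≥_ parts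

  ∣_∣ₚ : ℕ
  ∣_∣ₚ = sum parts

  ℓₚ : ℕ
  ℓₚ = length parts

  mult : ℕ → ℕ
  mult i = length (filter (_≟ i) parts)

open Partition public

oneTo : ℕ → List ℕ
oneTo = applyUpTo suc

-- m_λ = m₁(λ)! m₂(λ)! ⋯ ; a part of λ is at most |λ|, so the factors
-- with index above |λ| are 0! = 1.
multFactorial : Partition → ℕ
multFactorial ν = product (map (λ i → mult ν i !) (oneTo ∣ ν ∣ₚ))

multFactorial≢0 : ∀ ν → NonZero (multFactorial ν)
multFactorial≢0 ν =
  product≢0 (AllP.map⁺ (All.universal (λ i → mult ν i !≢0) (oneTo ∣ ν ∣ₚ)))

≥-decTotalOrder : DecTotalOrder _ _ _
≥-decTotalOrder = Flip.decTotalOrder ≤-decTotalOrder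

open Sort ≥-decTotalOrder using (sort; sort-↭; sort-↗)

-- The partition whose parts are the positive members of a list,
-- taken with repetition.
toPartition : List ℕ → Partition
toPartition xs = mkPartition (sort ys)
  (All-resp-↭ (↭-sym (sort-↭ ys)) (all-filter (0 <?_) xs)) (sort-↗ ys)
  where ys = filter (0 <?_) xs

data Tree : Set where
  node : List Tree → Tree

mutual
  edges : Tree → ℕ
  edges (node ts) = edgesᶠ ts

  -- Edges of a forest, counting one edge above each of its roots.
  edgesᶠ : List Tree → ℕ
  edgesᶠ []       = 0
  edgesᶠ (t ∷ ts) = suc (edges t + edgesᶠ ts)

mutual
  -- The numbers of children of the vertices, in pre-order.
  degrees : Tree → List ℕ
  degrees (node ts) = length ts ∷ degreesᶠ ts

  degreesᶠ : List Tree → List ℕ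
  degreesᶠ []       = []
  degreesᶠ (t ∷ ts) = degrees t ++ degreesᶠ ts

labelFrom : ℕ → List ℕ → List (ℕ × ℕ)
labelFrom j []       = []
labelFrom j (d ∷ ds) = (j , d) ∷ labelFrom (suc j) ds

-- The pairs (label, number of children) of the vertices in pre-order,
-- the root having label j.  Labels are not reduced modulo k + 1 here.
vertices : ℕ → Tree → List (ℕ × ℕ)
vertices j T = labelFrom j (degrees T)

Label≡1 : ℕ → ℕ × ℕ → Set
Label≡1 k (l , _) = l % suc k ≡ 1 % suc k

label≡1? : ∀ k → Decidable (Label≡1 k)
label≡1? k (l , _) = l % suc k ≟ 1 % suc k

ValidVertex : ℕ → ℕ × ℕ → Set
ValidVertex k v@(_ , d) =
  (Label≡1 k v → d ≡ 0 ⊎ d ≡ suc k) × (¬ Label≡1 k v → suc k ∣ d)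

validVertex? : ∀ k → Decidable (ValidVertex k)
validVertex? k v@(_ , d) =
  (label≡1? k v →-dec (d ≟ 0 ⊎-dec d ≟ suc k)) ×-dec
  (¬? (label≡1? k v) →-dec (suc k ∣? d))

-- Together with edges T ≡ suc k * n, this says that T is a j-rooted
-- (n,k)-valid tree.
Valid : (k j : ℕ) → Tree → Set
Valid k j T = All (ValidVertex k) (vertices j T)

valid? : ∀ k j → Decidable (Valid k j)
valid? k j T = All.all? (validVertex? k) (vertices j T)

-- For a valid tree the division is exact.
type : (k j : ℕ) → Tree → Partition
type k j T = toPartition
  (map (λ v → proj₂ v / suc k) (filter (¬? ∘ label≡1? k) (vertices j T)))

-- forests f s lists, for s ≤ f, the ordered forests F with edgesᶠ F ≡ s;
-- f is recursion fuel.
forests : ℕ → ℕ → List (List Tree)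
forests _       zero    = [] ∷ []
forests zero    (suc s) = []
forests (suc f) (suc s) = concatMap
  (λ i → cartesianProductWith (λ ts us → node ts ∷ us)
           (forests f i) (forests f (s ∸ i)))
  (upTo (suc s))

-- The plane trees with e edges, each listed exactly once; this is proved
-- in treesWith-sound, treesWith-complete and treesWith-unique.
treesWith : ℕ → List Tree
treesWith e = map node (forests e e)

validTrees : (k j n : ℕ) → List Tree
validTrees k j n = filter (valid? k j) (treesWith (suc k * n))

private
  node-injective : ∀ {ts us} → node ts ≡ node us → ts ≡ us
  node-injective refl = refl

  block : ℕ → ℕ → ℕ → List (List Tree)
  block f s i = cartesianProductWith (λ ts us → node ts ∷ us)
                  (forests f i) (forests f (s ∸ i))

  forests-sound : ∀ f s {F} → F ∈ forests f s → edgesᶠ F ≡ s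
  forests-sound zero    zero    (here refl) = refl
  forests-sound (suc f) zero    (here refl) = refl
  forests-sound (suc f) (suc s) F∈
    with i , i∈ , F∈b ← find (∈-concatMap⁻ (block f s) {upTo (suc s)} F∈)
    with ts , us , ts∈ , us∈ , refl ←
           ∈-cartesianProductWith⁻ (λ ts us → node ts ∷ us)
             (forests f i) (forests f (s ∸ i)) F∈b
    = cong suc (begin
        edgesᶠ ts + edgesᶠ us ≡⟨ cong₂ _+_ (forests-sound f i ts∈) (forests-sound f (s ∸ i) us∈) ⟩
        i + (s ∸ i)           ≡⟨ m+[n∸m]≡n (s≤s⁻¹ (∈-upTo⁻ i∈)) ⟩
        s                     ∎)
    where open ≡-Reasoning

  forests-complete : ∀ f F → edgesᶠ F ≤ f → F ∈ forests f (edgesᶠ F)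
  forests-complete zero    []             _         = here refl
  forests-complete (suc f) []             _         = here refl
  forests-complete (suc f) (node ts ∷ us) (s≤s a+b≤f) =
    ∈-concatMap⁺ (block f (a + b)) (lose (∈-upTo⁺ (s≤s (m≤m+n a b)))
      (∈-cartesianProductWith⁺ (λ ts us → node ts ∷ us)
        (forests-complete f ts (≤-trans (m≤m+n a b) a+b≤f))
        (subst (λ c → us ∈ forests f c) (sym (m+n∸m≡n a b))
          (forests-complete f us (≤-trans (m≤n+m b a) a+b≤f)))))
    where a = edgesᶠ ts
          b = edgesᶠ us

  forests-unique : ∀ f s → Unique (forests f s)
  forests-unique zero    zero    = [] ∷ []
  forests-unique (suc f) zero    = [] ∷ []
  forests-unique zero    (suc s) = []
  forests-unique (suc f) (suc s) = UniqueP.concat⁺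
    (AllP.map⁺ (All.universal block-unique (upTo (suc s))))
    (AllPairsP.map⁺ (AllPairs.map disjoint (UniqueP.upTo⁺ (suc s))))
    where
    cons-injective : ∀ {w x y z} → node w ∷ y ≡ node x ∷ z → w ≡ x × y ≡ z
    cons-injective eq =
      node-injective (proj₁ (∷-injective eq)) , proj₂ (∷-injective eq)

    block-unique : ∀ i → Unique (block f s i)
    block-unique i = UniqueP.cartesianProductWith⁺ _ cons-injective
      (forests-unique f i) (forests-unique f (s ∸ i))

    first : ∀ {F} i → F ∈ block f s i → map edges (take 1 F) ≡ i ∷ []
    first i F∈b
      with ts , us , ts∈ , us∈ , refl ←
             ∈-cartesianProductWith⁻ (λ ts us → node ts ∷ us)
               (forests f i) (forests f (s ∸ i)) F∈b
      = cong (_∷ []) (forests-sound f i ts∈)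

    disjoint : ∀ {i j} → i ≢ j → ∀ {F} → ¬ (F ∈ block f s i × F ∈ block f s j)
    disjoint i≢j (p , q) =
      i≢j (proj₁ (∷-injective (trans (sym (first _ p)) (first _ q))))

treesWith-sound : ∀ e {T} → T ∈ treesWith e → edges T ≡ e
treesWith-sound e T∈ with ts , ts∈ , refl ← ∈-map⁻ node T∈ = forests-sound e e ts∈

treesWith-complete : ∀ T → T ∈ treesWith (edges T)
treesWith-complete (node ts) = ∈-map⁺ node (forests-complete (edgesᶠ ts) ts ≤-refl)

treesWith-unique : ∀ e → Unique (treesWith e)
treesWith-unique e = UniqueP.map⁺ node-injective (forests-unique e e)

fromℕ : ℕ → ℚ
fromℕ a = + a /ℚ 1

ℓ!/m : Partition → ℚ
ℓ!/m ν = (+ (ℓₚ ν !) /ℚ multFactorial ν) ⦃ multFactorial≢0 ν ⦄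

coeffA : (k n : ℕ) .{{_ : NonZero n}} → Partition → ℚ
coeffA k n ν =
  (+ 1 /ℚ n) *ℚ (+ ∣ ν ∣ₚ /ℚ suc (k * n)) *ℚ fromℕ (n C ∣ ν ∣ₚ)
    *ℚ fromℕ (suc (k * n) C ℓₚ ν) *ℚ ℓ!/m ν

coeffB : (k n : ℕ) .{{_ : NonZero n}} → Partition → ℚ
coeffB k n ν =
  (+ 1 /ℚ n) *ℚ fromℕ (n C (∣ ν ∣ₚ + 1))
    *ℚ fromℕ ((k * n) C ℓₚ ν) *ℚ ℓ!/m ν

coeffAB : (k n : ℕ) .{{_ : NonZero n}} → Partition → ℚ
coeffAB k n ν =
  (+ 1 /ℚ n)
    *ℚ (fromℕ (n C (∣ ν ∣ₚ + 1))
        +ℚ (+ ∣ ν ∣ₚ /ℚ suc (k * n)) *ℚ fromℕ ((n + 1) C (∣ ν ∣ₚ + 1)))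
    *ℚ fromℕ (suc (k * n) C ℓₚ ν) *ℚ ℓ!/m ν

-- ι makes K a ℚ-algebra and t is a family of elements of K; the field of
-- rational functions ℂ(t₁, t₂, …) with its indeterminates is an instance.
-- The value t 0 is never used.
module GeneratingFunctions {c ℓ} (K : CommutativeRing c ℓ)
  (ι : ℚ → CommutativeRing.Carrier K) (t : ℕ → CommutativeRing.Carrier K) where

  open CommutativeRing K
    using (Carrier; _≈_; 0#; 1#; semiring)
    renaming (_+_ to _+ᴷ_; _*_ to _*ᴷ_)
  open import Algebra.Bundles using (Semiring)
  open import Algebra.Definitions.RawSemiring (Semiring.rawSemiring semiring)
    using () renaming (_^_ to _^ᴷ_)

  ∑ : {X : Set} → List X → (X → Carrier) → Carrier
  ∑ xs f = foldr _+ᴷ_ 0# (map f xs)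

  ∏ : {X : Set} → List X → (X → Carrier) → Carrier
  ∏ xs f = foldr _*ᴷ_ 1# (map f xs)

  -- Factors with index above |λ| have exponent 0.
  t^ : Partition → Carrier
  t^ ν = ∏ (oneTo ∣ ν ∣ₚ) (λ i → t i ^ᴷ mult ν i)

  -- An element of K[[x]], as its sequence of coefficients.
  PowerSeries : Set c
  PowerSeries = ℕ → Carrier

  _⊛_ : PowerSeries → PowerSeries → PowerSeries
  (f ⊛ g) n = ∑ (upTo (suc n)) (λ i → f i *ᴷ g (n ∸ i))

  treeSeries : (k j : ℕ) → PowerSeries
  treeSeries k j n = ∑ (validTrees k j n) (λ T → t^ (type k j T))

  A B : ℕ → PowerSeries
  A k = treeSeries k 0
  B k = treeSeries k 1

  -- a is the sum of f over all partitions, only finitely many of the terms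
  -- being nonzero.
  record IsSumOverPartitions (f : Partition → Carrier) (a : Carrier) : Set (c ⊔ ℓ) where
    field
      support  : List Partition
      distinct : Unique support
      outside  : ∀ {ν} → ν ∉ support → f ν ≈ 0#
      total    : a ≈ ∑ support f

  -- f = 1 + ∑_{n ≥ 1} ∑_λ coeff n λ t^λ xⁿ, coefficient by coefficient in x.
  _≈1+∑_ : PowerSeries → ((n : ℕ) .{{_ : NonZero n}} → Partition → ℚ) → Set (c ⊔ ℓ)
  f ≈1+∑ coeff =
    f 0 ≈ 1# ×
    (∀ n .{{_ : NonZero n}} → IsSumOverPartitions (λ ν → ι (coeff n ν) *ᴷ t^ ν) (f n))

{-# OPTIONS --safe #-}

-- Every number of children in a valid tree is a multiple of k + 1.  Reading a forest in pre-order,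
-- a block of k + 1 consecutive labels therefore acts like one vertex whose number of children,
-- divided by k + 1, has the generating function φ(y) = T(y)ᵏ (1 + y), where T(y) = 1 + ∑ tₘ yᵐ; the
-- factor 1 + y belongs to the label ≡ 1.  Splitting off the root gives A = T(y) and B = 1 + y, where
-- y = x φ(y), and Lagrange inversion
--   n [xⁿ] H(y(x)) = [yⁿ] (y H′(y)) φ(y)ⁿ
-- is applied to H = T, 1 + y and T (1 + y).  The formulas follow from
-- (a + 1) T′ Tᵃ = (T^(a+1))′ and from the expansion of powers of T as sums over partitions.
-- Lagrange inversion itself is proved without composing power series, by induction from
--   [xⁿ] yʳ = ∑_m φₘ [xⁿ⁻¹] y^(r-1+m).

module Submission where

open import Defs
open import Algebra.Bundles
open import Algebra.Morphism.Structures using (module RingMorphisms)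
open import Algebra.Structures.Biased
open import Data.Bool.Base using (true; false; if_then_else_)
open import Data.Fin.Base using (toℕ)
open import Data.Integer.Base as ℤ using () renaming (+_ to pos)
import Data.Integer.Properties as ℤ
open import Data.List.Base
  using (List; []; _∷_; _++_; map; foldr; filter; length; replicate; concatMap;
         cartesianProductWith; upTo; applyUpTo)
open import Data.List.Membership.Propositional using (_∈_; _∉_)
open import Data.List.Membership.Propositional.Properties
  using (∈-upTo⁺; ∈-cartesianProductWith⁺; ∈-map⁺)
import Data.List.Properties as List
open import Data.List.Relation.Binary.Permutation.Propositional as ↭ using (_↭_)
open import Data.List.Relation.Unary.All as All using (All; []; _∷_)
import Data.List.Relation.Unary.All.Properties as All
open import Data.List.Relation.Unary.AllPairs using (AllPairs; []; _∷_)
open import Data.List.Relation.Unary.Any using (here)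
open import Data.List.Relation.Unary.Linked using (linked?)
open import Data.List.Relation.Unary.Linked.Properties using (AllPairs⇒Linked; Linked⇒AllPairs)
open import Data.List.Relation.Unary.Unique.Propositional using (Unique)
import Data.List.Relation.Unary.Unique.Propositional.Properties as Unique
open import Data.List.Sort ≥-decTotalOrder using (sort-↭)
open import Data.Nat.Base as ℕ using (ℕ; zero; suc; NonZero; _≤_; _∸_; _!)
open import Data.Nat.Combinatorics
  using (_C_; nCk+nC[k+1]≡[n+1]C[k+1]; k>n⇒nCk≡0; nCk≡nC[n∸k]; nCn≡1)
open import Data.Nat.Divisibility using (_∣_; _∣?_; divides; m∣m*n; >⇒∤; ∣m+n∣m⇒∣n)
open import Data.Nat.DivMod using (_/_; _%_)
import Data.Nat.DivMod as ℕ
open import Data.Nat.ListAction using (sum; product)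
import Data.Nat.ListAction.Properties as ListAction
import Data.Nat.Properties as ℕ
open import Data.Nat.Solver using (module +-*-Solver)
open import Data.Product.Base using (∃; _×_; _,_; proj₂; uncurry)
open import Data.Rational.Base using (ℚ; toℚᵘ; 1ℚ; +-*-rawRing)
  renaming (_+_ to _+ℚ_; _*_ to _*ℚ_; _/_ to _/ℚ_)
import Data.Rational.Properties as ℚ
open import Data.Rational.Unnormalised.Base as ℚᵘ using (mkℚᵘ; *≡*)
import Data.Rational.Unnormalised.Properties as ℚᵘ
open import Data.Sum.Base using (_⊎_; inj₁; inj₂)
open import Data.Vec.Base using (Vec; []; _∷_)
import Data.Vec.Properties as Vec
open import Function.Base using (_∘_; id; case_of_)
open import Level using (0ℓ)
open import Relation.Binary.PropositionalEquality as ≡ using (_≡_; _≢_)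
open import Relation.Nullary using (¬_; Dec; yes; no; does; contradiction)
open import Relation.Nullary.Decidable using (dec-true; dec-false; ¬?; recompute)
open import Relation.Unary using (Pred; Decidable)
open import Algebra.Properties.CommutativeSemigroup ℕ.+-commutativeSemigroup
  using () renaming (xy∙z≈xz∙y to ℕ-xy∙z≈xz∙y)

-- Antidiagonal sums, power series and weighted forests

-- Whether a vertex is admissible depends on its label, hence on the sizes of all subtrees to its
-- left, so a valid tree does not split into independent valid subtrees. The way out is to treat
-- pre-order as a stack: the next vertex leaves the stack and its children enter in front. The
-- number of pending roots and the current label are then the whole state, and validity becomes a
-- product of local weights, each of which vanishes at a bad vertex. Reading k + 1 vertices trades
-- one group of k + 1 pending roots for m such groups and restores the label modulo k + 1, so groups
-- of roots satisfy the recursion of forests whose vertices all carry the weight φ. This recursion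
-- takes the place of the series y: its solution `c m q` stands for [x^(m+q)] y^m, and the
-- coefficient of H(y) is by definition the sum of the products H m * c m q.

module Series {a ℓ} (R : CommutativeSemiring a ℓ) where

  open CommutativeSemiring R renaming (zero to *-zero)
  open import Algebra.Properties.Semiring.Mult semiring
    using (×-homo-+; ×1-homo-*) renaming (_×_ to _×ᴷ_)
  open import Algebra.Properties.CommutativeSemigroup +-commutativeSemigroup
    using () renaming (interchange to +-interchange)
  open import Algebra.Properties.CommutativeSemigroup *-commutativeSemigroup
    using (x∙yz≈y∙xz; x∙yz≈yx∙z) renaming (interchange to *-interchange)
  open import Relation.Binary.Reasoning.Setoid setoid

  -- anti h n = ∑_{i + j = n} h i j
  anti : (ℕ → ℕ → Carrier) → ℕ → Carrier
  anti h zero    = h 0 0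
  anti h (suc n) = h 0 (suc n) + anti (λ i → h (suc i)) n

  anti-cong : ∀ n {h h′} → (∀ i j → i ℕ.+ j ≡ n → h i j ≈ h′ i j) → anti h n ≈ anti h′ n
  anti-cong zero    h≈ = h≈ 0 0 ≡.refl
  anti-cong (suc n) h≈ = +-cong (h≈ 0 (suc n) ≡.refl)
    (anti-cong n λ i j eq → h≈ (suc i) j (≡.cong suc eq))

  anti-0 : ∀ n {h} → (∀ i j → i ℕ.+ j ≡ n → h i j ≈ 0#) → anti h n ≈ 0#
  anti-0 zero    h≈ = h≈ 0 0 ≡.refl
  anti-0 (suc n) h≈ = trans
    (+-cong (h≈ 0 (suc n) ≡.refl) (anti-0 n λ i j eq → h≈ (suc i) j (≡.cong suc eq)))
    (+-identityˡ 0#)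

  anti-+ : ∀ n (f g : ℕ → ℕ → Carrier) →
           anti (λ i j → f i j + g i j) n ≈ anti f n + anti g n
  anti-+ zero    f g = refl
  anti-+ (suc n) f g = trans (+-congˡ (anti-+ n _ _)) (+-interchange _ _ _ _)

  *-anti : ∀ n x (h : ℕ → ℕ → Carrier) → x * anti h n ≈ anti (λ i j → x * h i j) n
  *-anti zero    x h = refl
  *-anti (suc n) x h = trans (distribˡ x _ _) (+-congˡ (*-anti n x _))

  anti-* : ∀ n x (h : ℕ → ℕ → Carrier) → anti h n * x ≈ anti (λ i j → h i j * x) n
  anti-* zero    x h = refl
  anti-* (suc n) x h = trans (distribʳ x _ _) (+-congˡ (anti-* n x _))

  anti-last : ∀ n (h : ℕ → ℕ → Carrier) →
              anti h (suc n) ≈ anti (λ i j → h i (suc j)) n + h (suc n) 0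
  anti-last zero    h = refl
  anti-last (suc n) h = trans (+-congˡ (anti-last n (h ∘ suc))) (sym (+-assoc _ _ _))

  anti-comm : ∀ n (h : ℕ → ℕ → Carrier) → anti h n ≈ anti (λ i j → h j i) n
  anti-comm zero    h = refl
  anti-comm (suc n) h = begin
    h 0 (suc n) + anti (λ i → h (suc i)) n     ≈⟨ +-congˡ (anti-comm n _) ⟩
    h 0 (suc n) + anti (λ i j → h (suc j) i) n ≈⟨ +-comm _ _ ⟩
    anti (λ i j → h (suc j) i) n + h 0 (suc n) ≈⟨ anti-last n (λ i j → h j i) ⟨
    anti (λ i j → h j i) (suc n)               ∎

  -- Both sides range over x + y + z = n. An arbitrary kernel of three indices covers regroupings of
  -- forests as well as the associativity of `_⊗_`.
  anti-assoc : ∀ n (h : ℕ → ℕ → ℕ → Carrier) →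
               anti (λ r z → anti (λ x y → h x y z) r) n ≈ anti (λ x → anti (h x)) n
  anti-assoc zero    h = refl
  anti-assoc (suc n) h = begin
    h 0 0 (suc n) + anti (λ r z → h 0 (suc r) z + anti (λ x y → h (suc x) y z) r) n
      ≈⟨ +-congˡ (anti-+ n _ _) ⟩
    h 0 0 (suc n) + (anti (λ y → h 0 (suc y)) n + anti (λ r z → anti (λ x y → h (suc x) y z) r) n)
      ≈⟨ +-assoc _ _ _ ⟨
    anti (h 0) (suc n) + anti (λ r z → anti (λ x y → h (suc x) y z) r) n
      ≈⟨ +-congˡ (anti-assoc n (h ∘ suc)) ⟩
    anti (h 0) (suc n) + anti (λ x → anti (h (suc x))) n ∎

  anti-swap : ∀ n (h : ℕ → ℕ → ℕ → Carrier) →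
              anti (λ x → anti (h x)) n ≈ anti (λ y → anti (λ x → h x y)) n
  anti-swap n h = begin
    anti (λ x → anti (h x)) n                 ≈⟨ anti-assoc n h ⟨
    anti (λ r z → anti (λ x y → h x y z) r) n ≈⟨ anti-cong n (λ r z _ → anti-comm r _) ⟩
    anti (λ r z → anti (λ x y → h y x z) r) n ≈⟨ anti-assoc n (λ y x → h x y) ⟩
    anti (λ y → anti (λ x → h x y)) n         ∎

  -- Quadruples with sum n, grouped as (a + b) + (c + d) and then as (a + c) + (b + d). For two
  -- factors that carry a pair of indices each, this collects exponents with exponents and roots
  -- with roots.
  anti-interchange : ∀ n (h : ℕ → ℕ → ℕ → ℕ → Carrier) →
    anti (λ i j → anti (λ a b → anti (h a b) j) i) n ≈
    anti (λ x y → anti (λ a c → anti (λ b → h a b c) y) x) n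
  anti-interchange n h = begin
    anti (λ i j → anti (λ a b → anti (h a b) j) i) n         ≈⟨ anti-assoc n (λ a b → anti (h a b)) ⟩
    anti (λ a → anti (λ b → anti (h a b))) n                 ≈⟨ anti-cong n (λ a s _ → anti-swap s (h a)) ⟩
    anti (λ a → anti (λ c → anti (λ b → h a b c))) n         ≈⟨ anti-assoc n (λ a c → anti (λ b → h a b c)) ⟨
    anti (λ x y → anti (λ a c → anti (λ b → h a b c) y) x) n ∎

  anti-drop : ∀ r n (h : ℕ → ℕ → Carrier) → (∀ i j → i ℕ.< r → h i j ≈ 0#) →
              anti h (r ℕ.+ n) ≈ anti (λ i → h (r ℕ.+ i)) n
  anti-drop zero    n h h≈0 = refl
  anti-drop (suc r) n h h≈0 = begin
    h 0 _ + anti (λ i → h (suc i)) (r ℕ.+ n)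
      ≈⟨ +-cong (h≈0 0 _ ℕ.z<s) (anti-drop r n _ λ i j i<r → h≈0 (suc i) j (ℕ.s<s i<r)) ⟩
    0# + anti (λ i → h (suc r ℕ.+ i)) n
      ≈⟨ +-identityˡ _ ⟩
    anti (λ i → h (suc r ℕ.+ i)) n ∎

  -- One period at a time: after the index 0 the next k indices contribute nothing, and dropping
  -- them shifts `h` by κ.
  anti-multiples : ∀ κ .{{_ : ℕ.NonZero κ}} n (h : ℕ → ℕ → Carrier) →
    (∀ m i j → 0 ℕ.< i → i ℕ.< κ → h (κ ℕ.* m ℕ.+ i) j ≈ 0#) →
    anti h (κ ℕ.* n) ≈ anti (λ i j → h (κ ℕ.* i) (κ ℕ.* j)) n
  anti-multiples κ@(suc k) zero h h≈0
    rewrite ℕ.*-zeroʳ k = refl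
  anti-multiples κ@(suc k) (suc n) h h≈0 = begin
    anti h (κ ℕ.* suc n)
      ≡⟨ ≡.cong (anti h) (ℕ.*-suc κ n) ⟩
    h 0 (κ ℕ.+ κ ℕ.* n) + anti (λ i → h (suc i)) (k ℕ.+ κ ℕ.* n)
      ≈⟨ +-cong (reflexive (≡.cong₂ h (≡.sym (ℕ.*-zeroʳ κ)) (≡.sym (ℕ.*-suc κ n))))
          (anti-drop k (κ ℕ.* n) _ λ i j i<k → trans
            (reflexive (≡.cong (λ x → h (x ℕ.+ suc i) j) (≡.sym (ℕ.*-zeroʳ κ))))
            (h≈0 0 (suc i) j ℕ.z<s (ℕ.s<s i<k))) ⟩
    h (κ ℕ.* 0) (κ ℕ.* suc n) + anti (λ i → h (κ ℕ.+ i)) (κ ℕ.* n)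
      ≈⟨ +-congˡ (anti-multiples κ n _ λ m i j 0<i i<κ → trans
           (reflexive (≡.cong (λ x → h x j)
             (≡.trans (≡.sym (ℕ.+-assoc κ (κ ℕ.* m) i)) (≡.cong (ℕ._+ i) (≡.sym (ℕ.*-suc κ m))))))
           (h≈0 (suc m) i j 0<i i<κ)) ⟩
    h (κ ℕ.* 0) (κ ℕ.* suc n) + anti (λ i j → h (κ ℕ.+ κ ℕ.* i) (κ ℕ.* j)) n
      ≈⟨ +-congˡ (anti-cong n λ i j _ → reflexive (≡.cong (λ x → h x (κ ℕ.* j)) (≡.sym (ℕ.*-suc κ i)))) ⟩
    anti (λ i j → h (κ ℕ.* i) (κ ℕ.* j)) (suc n) ∎

  -- Formal power series

  Pow : Set a
  Pow = ℕ → Carrier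

  infix 4 _≋_
  _≋_ : Pow → Pow → Set ℓ
  f ≋ g = ∀ n → f n ≈ g n

  infixl 6 _⊕_
  infixl 7 _⊗_
  _⊕_ _⊗_ : Pow → Pow → Pow
  (f ⊕ g) n = f n + g n
  (f ⊗ g) n = anti (λ i j → f i * g j) n

  const : Carrier → Pow
  const x zero    = x
  const x (suc n) = 0#

  anti-const : ∀ x n (h : ℕ → ℕ → Carrier) → anti (λ i j → const x i * h i j) n ≈ x * h 0 n
  anti-const x zero    h = refl
  anti-const x (suc n) h = trans (+-congˡ (anti-0 n λ i j _ → zeroˡ _)) (+-identityʳ _)

  const-⊗ : ∀ x f n → (const x ⊗ f) n ≈ x * f n
  const-⊗ x f n = anti-const x n λ _ → f

  -- With the full structure in place, powers, natural multiples and the binomial theorem for power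
  -- series come from the general theory of commutative semirings.
  series : CommutativeSemiring a ℓ
  series = record
    { Carrier = Pow ; _≈_ = _≋_ ; _+_ = _⊕_ ; _*_ = _⊗_ ; 0# = λ _ → 0# ; 1# = const 1#
    ; isCommutativeSemiring = isCommutativeSemiringˡ record
      { +-isCommutativeMonoid = record
        { isMonoid = record
          { isSemigroup = record
            { isMagma = record
              { isEquivalence = record
                { refl  = λ _ → refl
                ; sym   = λ f≋g n → sym (f≋g n)
                ; trans = λ f≋g g≋h n → trans (f≋g n) (g≋h n) }
              ; ∙-cong = λ f≋ g≋ n → +-cong (f≋ n) (g≋ n) }
            ; assoc = λ f g h n → +-assoc (f n) (g n) (h n) }
          ; identity = (λ f n → +-identityˡ (f n)) , (λ f n → +-identityʳ (f n)) }
        ; comm = λ f g n → +-comm (f n) (g n) }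
      ; *-isCommutativeMonoid = isCommutativeMonoidˡ record
        { isSemigroup = record
          { isMagma = record
            { isEquivalence = record
              { refl  = λ _ → refl
              ; sym   = λ f≋g n → sym (f≋g n)
              ; trans = λ f≋g g≋h n → trans (f≋g n) (g≋h n) }
            ; ∙-cong = λ f≋ g≋ n → anti-cong n λ i j _ → *-cong (f≋ i) (g≋ j) }
          ; assoc = ⊗-assoc }
        ; identityˡ = λ f n → trans (const-⊗ 1# f n) (*-identityˡ (f n))
        ; comm = λ f g n → trans (anti-comm n _) (anti-cong n λ i j _ → *-comm (f j) (g i)) }
      ; distribʳ = λ f g h n → trans
          (anti-cong n λ i j _ → distribʳ (f j) (g i) (h i)) (anti-+ n _ _)
      ; zeroˡ = λ f n → anti-0 n λ i j _ → zeroˡ (f j) } }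
    where
    ⊗-assoc : ∀ f g h → (f ⊗ g) ⊗ h ≋ f ⊗ (g ⊗ h)
    ⊗-assoc f g h n = begin
      anti (λ r z → anti (λ x y → f x * g y) r * h z) n
        ≈⟨ anti-cong n (λ r z _ → trans (anti-* r (h z) _) (anti-cong r λ x y _ → *-assoc _ _ _)) ⟩
      anti (λ r z → anti (λ x y → f x * (g y * h z)) r) n
        ≈⟨ anti-assoc n _ ⟩
      anti (λ x → anti (λ y z → f x * (g y * h z))) n
        ≈⟨ anti-cong n (λ x s _ → *-anti s (f x) _) ⟨
      anti (λ x s → f x * anti (λ y z → g y * h z) s) n ∎

  module P = CommutativeSemiring series
  open import Algebra.Properties.CommutativeSemiring.Exp series public
    using () renaming (_^_ to _^ᴾ_; ^-distrib-* to ^ᴾ-distrib-*; ^-assocʳ to ^ᴾ-assocʳ)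
  open import Algebra.Properties.Semiring.Mult P.semiring public
    using ()
    renaming (_×_ to _×ᴾ_; ×-comm-* to ×ᴾ-comm-*; ×-assoc-* to ×ᴾ-assoc-*; ×-congʳ to ×ᴾ-congʳ)

  ⟦_⟧ : ℕ → Carrier
  ⟦ n ⟧ = n ×ᴷ 1#

  ⟦⟧-homo-+ : ∀ m n → ⟦ m ℕ.+ n ⟧ ≈ ⟦ m ⟧ + ⟦ n ⟧
  ⟦⟧-homo-+ = ×-homo-+ 1#

  ⟦⟧-homo-* : ∀ m n → ⟦ m ℕ.* n ⟧ ≈ ⟦ m ⟧ * ⟦ n ⟧
  ⟦⟧-homo-* = ×1-homo-*

  ⟦1⟧ : ⟦ 1 ⟧ ≈ 1#
  ⟦1⟧ = +-identityʳ 1#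

  ×ᴾ-coeff : ∀ n f i → (n ×ᴾ f) i ≈ ⟦ n ⟧ * f i
  ×ᴾ-coeff zero    f i = sym (zeroˡ _)
  ×ᴾ-coeff (suc n) f i = sym (trans (distribʳ _ _ _)
    (+-cong (*-identityˡ _) (sym (×ᴾ-coeff n f i))))

  -- The Euler operator y d/dy. Unlike d/dy it shifts no index, so the Leibniz rule is n = i + j
  -- under the antidiagonal sum, and the monomials are eigenvectors.
  D : Pow → Pow
  D f n = ⟦ n ⟧ * f n

  D-⊗ : ∀ f g → D (f ⊗ g) ≋ D f ⊗ g ⊕ f ⊗ D g
  D-⊗ f g n = begin
    ⟦ n ⟧ * anti (λ i j → f i * g j) n
      ≈⟨ *-anti n _ _ ⟩
    anti (λ i j → ⟦ n ⟧ * (f i * g j)) n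
      ≈⟨ anti-cong n split ⟩
    anti (λ i j → ⟦ i ⟧ * f i * g j + f i * (⟦ j ⟧ * g j)) n
      ≈⟨ anti-+ n _ _ ⟩
    (D f ⊗ g ⊕ f ⊗ D g) n ∎
    where
    split : ∀ i j → i ℕ.+ j ≡ n →
            ⟦ n ⟧ * (f i * g j) ≈ ⟦ i ⟧ * f i * g j + f i * (⟦ j ⟧ * g j)
    split i j ≡.refl = begin
      ⟦ i ℕ.+ j ⟧ * (f i * g j)                       ≈⟨ *-congʳ (⟦⟧-homo-+ i j) ⟩
      (⟦ i ⟧ + ⟦ j ⟧) * (f i * g j)                   ≈⟨ distribʳ _ _ _ ⟩
      ⟦ i ⟧ * (f i * g j) + ⟦ j ⟧ * (f i * g j)       ≈⟨ +-cong (sym (*-assoc _ _ _)) (x∙yz≈y∙xz _ _ _) ⟩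
      ⟦ i ⟧ * f i * g j + f i * (⟦ j ⟧ * g j)         ∎

  D-1 : D P.1# ≋ P.0#
  D-1 zero    = zeroˡ _
  D-1 (suc n) = zeroʳ _

  D-^ : ∀ f n → D (f ^ᴾ suc n) ≋ suc n ×ᴾ (D f ⊗ f ^ᴾ n)
  D-^ f zero = P.trans (D-⊗ f P.1#)
    (P.+-congˡ (P.trans (P.*-congˡ {f} D-1) (P.zeroʳ f)))
  D-^ f (suc n) = P.trans (D-⊗ f (f ^ᴾ suc n)) (P.+-congˡ
    (P.trans (P.*-congˡ {f} (D-^ f n))
      (P.trans (×ᴾ-comm-* (suc n) f (D f ⊗ f ^ᴾ n))
        (×ᴾ-congʳ (suc n) (P.trans (P.sym (P.*-assoc f (D f) _))
          (P.trans (P.*-congʳ (P.*-comm f (D f))) (P.*-assoc (D f) f _)))))))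

  -- The first argument of forestWeightᵉ is recursion fuel; it always equals s + q.
  forestWeightᵉ : (ℕ → ℕ → Carrier) → ℕ → ℕ → ℕ → ℕ → Carrier
  forestWeightᵉ w zero    s       q j = 1#
  forestWeightᵉ w (suc e) zero    q j = 0#
  forestWeightᵉ w (suc e) (suc s) q j =
    anti (λ d q′ → w j d * forestWeightᵉ w e (s ℕ.+ d) q′ (suc j)) q

  -- The total weight of the plane forests with s roots and q further vertices, labelled in
  -- pre-order from j on, where a vertex with label l and d children has weight w l d.
  forestWeight : (ℕ → ℕ → Carrier) → ℕ → ℕ → ℕ → Carrier
  forestWeight w s q = forestWeightᵉ w (s ℕ.+ q) s q

  -- Reading the first root replaces it by its d children, placed in front of the other s roots; d
  -- of the q further vertices thereby become roots. The fuel s + q left by the definition equals (s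
  -- + d) + q′.
  forestWeight-suc : ∀ w s q j →
    forestWeight w (suc s) q j ≈ anti (λ d q′ → w j d * forestWeight w (s ℕ.+ d) q′ (suc j)) q
  forestWeight-suc w s q j = anti-cong q λ d q′ d+q′≡q → *-congˡ (reflexive
    (≡.cong (λ e → forestWeightᵉ w e (s ℕ.+ d) q′ (suc j))
      (≡.trans (≡.cong (s ℕ.+_) (≡.sym d+q′≡q)) (≡.sym (ℕ.+-assoc s d q′)))))

  forestWeight-relabel : ∀ {w w′} s q j j′ → (∀ i d → w (j ℕ.+ i) d ≈ w′ (j′ ℕ.+ i) d) →
    forestWeight w s q j ≈ forestWeight w′ s q j′
  forestWeight-relabel {w} {w′} s q = go (s ℕ.+ q) s q
    where
    go : ∀ e s q j j′ → (∀ i d → w (j ℕ.+ i) d ≈ w′ (j′ ℕ.+ i) d) →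
         forestWeightᵉ w e s q j ≈ forestWeightᵉ w′ e s q j′
    go zero    s       q j j′ w≈ = refl
    go (suc e) zero    q j j′ w≈ = refl
    go (suc e) (suc s) q j j′ w≈ = anti-cong q λ d q′ _ → *-cong
      (trans (reflexive (≡.cong (λ l → w l d) (≡.sym (ℕ.+-identityʳ j))))
        (trans (w≈ 0 d) (reflexive (≡.cong (λ l → w′ l d) (ℕ.+-identityʳ j′)))))
      (go e (s ℕ.+ d) q′ (suc j) (suc j′) λ i d →
        trans (reflexive (≡.cong (λ l → w l d) (≡.sym (ℕ.+-suc j i))))
          (trans (w≈ (suc i) d) (reflexive (≡.cong (λ l → w′ l d) (ℕ.+-suc j′ i)))))

  -- Cut after the first d trees: they hold d + q₁ vertices, and this is the label shift of the
  -- rest. The induction reads one root, which changes d to an arbitrary larger number, so it runs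
  -- on d + q instead of d.
  forestWeight-+ : ∀ w d s q j →
    forestWeight w (d ℕ.+ s) q j ≈
    anti (λ q₁ q₂ → forestWeight w d q₁ j * forestWeight w s q₂ (j ℕ.+ (d ℕ.+ q₁))) q
  forestWeight-+ w d s q j = go (d ℕ.+ q) d s q j ≡.refl
    where
    go : ∀ e d s q j → d ℕ.+ q ≡ e → forestWeight w (d ℕ.+ s) q j ≈
         anti (λ q₁ q₂ → forestWeight w d q₁ j * forestWeight w s q₂ (j ℕ.+ (d ℕ.+ q₁))) q
    go e zero s zero j _ = trans
      (reflexive (≡.cong (forestWeight w s 0) (≡.sym (ℕ.+-identityʳ j)))) (sym (*-identityˡ _))
    go e zero s (suc q) j _ = trans
      (reflexive (≡.cong (forestWeight w s (suc q)) (≡.sym (ℕ.+-identityʳ j))))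
      (sym (trans (+-cong (*-identityˡ _) (anti-0 q λ _ _ _ → zeroˡ _)) (+-identityʳ _)))
    go (suc e) (suc d) s q j eq = begin
      V (suc d ℕ.+ s) q j
        ≈⟨ forestWeight-suc w (d ℕ.+ s) q j ⟩
      anti (λ x z → w j x * V (d ℕ.+ s ℕ.+ x) z (suc j)) q
        ≈⟨ anti-cong q step ⟩
      anti (λ x z → w j x * anti (λ y q₂ → V (d ℕ.+ x) y (suc j) * V s q₂ (suc j ℕ.+ (d ℕ.+ x ℕ.+ y))) z) q
        ≈⟨ anti-cong q (λ x z _ → trans (*-anti z _ _) (anti-cong z λ y q₂ _ → sym (*-assoc _ _ _))) ⟩
      anti (λ x → anti (λ y q₂ → w j x * V (d ℕ.+ x) y (suc j) * V s q₂ (suc j ℕ.+ (d ℕ.+ x ℕ.+ y)))) q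
        ≈⟨ anti-assoc q _ ⟨
      anti (λ q₁ q₂ → anti (λ x y → w j x * V (d ℕ.+ x) y (suc j) * V s q₂ (suc j ℕ.+ (d ℕ.+ x ℕ.+ y))) q₁) q
        ≈⟨ anti-cong q (λ q₁ q₂ _ → anti-cong q₁ λ x y x+y≡q₁ → *-congˡ
             (reflexive (≡.cong (V s q₂) (labels x y x+y≡q₁)))) ⟩
      anti (λ q₁ q₂ → anti (λ x y → w j x * V (d ℕ.+ x) y (suc j) * V s q₂ (j ℕ.+ (suc d ℕ.+ q₁))) q₁) q
        ≈⟨ anti-cong q (λ q₁ q₂ _ → anti-* q₁ _ _) ⟨
      anti (λ q₁ q₂ → anti (λ x y → w j x * V (d ℕ.+ x) y (suc j)) q₁ * V s q₂ (j ℕ.+ (suc d ℕ.+ q₁))) q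
        ≈⟨ anti-cong q (λ q₁ q₂ _ → *-congʳ (forestWeight-suc w d q₁ j)) ⟨
      anti (λ q₁ q₂ → V (suc d) q₁ j * V s q₂ (j ℕ.+ (suc d ℕ.+ q₁))) q ∎
      where
      V = forestWeight w
      labels : ∀ x y {q₁} → x ℕ.+ y ≡ q₁ → suc j ℕ.+ (d ℕ.+ x ℕ.+ y) ≡ j ℕ.+ (suc d ℕ.+ q₁)
      labels x y ≡.refl = ≡.trans (≡.sym (ℕ.+-suc j _)) (≡.cong (λ l → j ℕ.+ suc l) (ℕ.+-assoc d x y))
      step : ∀ x z → x ℕ.+ z ≡ q → w j x * V (d ℕ.+ s ℕ.+ x) z (suc j) ≈
             w j x * anti (λ y q₂ → V (d ℕ.+ x) y (suc j) * V s q₂ (suc j ℕ.+ (d ℕ.+ x ℕ.+ y))) z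
      step x z x+z≡q = *-congˡ (trans
        (reflexive (≡.cong (λ r → V r z (suc j)) (ℕ-xy∙z≈xz∙y d s x)))
        (go e (d ℕ.+ x) s z (suc j)
          (≡.trans (ℕ.+-assoc d x z) (≡.trans (≡.cong (d ℕ.+_) x+z≡q) (ℕ.suc-injective eq)))))

  -- The coefficients c r q = [x^(r+q)] yʳ of the powers of the solution of y = x φ(y).
  module Lagrange (φ : Pow) (cancel : ∀ n {x y} → ⟦ suc n ⟧ * x ≈ ⟦ suc n ⟧ * y → x ≈ y) where

    c : ℕ → ℕ → Carrier
    c r q = forestWeight (λ _ → φ) r q 0

    c-label : ∀ r q j → forestWeight (λ _ → φ) r q j ≈ c r q
    c-label r q j = forestWeight-relabel r q j 0 λ _ _ → refl

    c-suc : ∀ r q → c (suc r) q ≈ anti (λ d q′ → φ d * c (r ℕ.+ d) q′) q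
    c-suc r q = trans (forestWeight-suc (λ _ → φ) r q 0)
      (anti-cong q λ d q′ _ → *-congˡ (c-label (r ℕ.+ d) q′ 1))

    -- The recurrence lowers r + q by one and so determines all values. This is how weights that
    -- depend on labels are later identified with `c`.
    c-unique : (g : ℕ → ℕ → Carrier) → g 0 0 ≈ 1# → (∀ q → g 0 (suc q) ≈ 0#) →
      (∀ r q → g (suc r) q ≈ anti (λ d q′ → φ d * g (r ℕ.+ d) q′) q) → ∀ r q → g r q ≈ c r q
    c-unique g g00 g0s gs r q = go (r ℕ.+ q) r q ≡.refl
      where
      go : ∀ e r q → r ℕ.+ q ≡ e → g r q ≈ c r q
      go e       zero    zero    _  = g00
      go e       zero    (suc q) _  = g0s q
      go (suc e) (suc r) q       eq = trans (gs r q) (trans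
        (anti-cong q λ d q′ d+q′≡q → *-congˡ (go e (r ℕ.+ d) q′
          (≡.trans (ℕ.+-assoc r d q′) (≡.trans (≡.cong (r ℕ.+_) d+q′≡q) (ℕ.suc-injective eq)))))
        (sym (c-suc r q)))

    -- Substitution of y is multiplicative because y^a y^a′ = y^(a+a′), which for forests is the cut
    -- `forestWeight-+`. It is what makes Lagrange inversion applicable to the product of A and B.
    ⊗-c : ∀ (F G : Pow) n →
      anti (λ i j → anti (λ a b → F a * c a b) i * anti (λ a b → G a * c a b) j) n ≈
      anti (λ m q → (F ⊗ G) m * c m q) n
    ⊗-c F G n = begin
      anti (λ i j → anti (λ a b → F a * c a b) i * anti (λ a′ b′ → G a′ * c a′ b′) j) n
        ≈⟨ anti-cong n (λ i j _ → trans (anti-* i _ _) (anti-cong i λ a b _ → trans (*-anti j _ _)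
             (anti-cong j λ a′ b′ _ → *-interchange _ _ _ _))) ⟩
      anti (λ i j → anti (λ a b → anti (λ a′ b′ → F a * G a′ * (c a b * c a′ b′)) j) i) n
        ≈⟨ anti-interchange n (λ a b a′ b′ → F a * G a′ * (c a b * c a′ b′)) ⟩
      anti (λ m q → anti (λ a a′ → anti (λ b b′ → F a * G a′ * (c a b * c a′ b′)) q) m) n
        ≈⟨ anti-cong n (λ m q _ → trans
             (anti-cong m λ a a′ a+a′≡m → trans (sym (*-anti q _ _)) (*-congˡ (merge a a′ q a+a′≡m)))
             (sym (anti-* m _ _))) ⟩
      anti (λ m q → (F ⊗ G) m * c m q) n ∎
      where
      merge : ∀ a a′ q {m} → a ℕ.+ a′ ≡ m → anti (λ b b′ → c a b * c a′ b′) q ≈ c m q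
      merge a a′ q ≡.refl = sym (trans (forestWeight-+ (λ _ → φ) a a′ q 0)
        (anti-cong q λ b b′ _ → *-congˡ (c-label a′ b′ _)))

    -- Lagrange inversion for H = y^r, cleared of denominators so that r = q = 0 is included.
    Lagrange[_,_] : ℕ → ℕ → Set ℓ
    Lagrange[ r , q ] = ⟦ r ℕ.+ q ⟧ * c r q ≈ ⟦ r ⟧ * (φ ^ᴾ (r ℕ.+ q)) q

    -- Put X = [y^q] φ^(N+1). The hypotheses turn N times `c (suc r) q` into r X + [y^q] (D φ) φ^N.
    -- Multiplied by N + 1, the second term is the coefficient of D (φ^(N+1)), that is q X, and (N +
    -- 1) r + q = N (r + 1). Finally N is cancelled, so N = 0 is a case of its own.
    lagrange-suc : ∀ N r q → r ℕ.+ q ≡ N →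
      (∀ d q′ → d ℕ.+ q′ ≡ q → Lagrange[ r ℕ.+ d , q′ ]) → Lagrange[ suc r , q ]
    lagrange-suc zero    zero zero _     _  = refl
    lagrange-suc (suc e) r    q    r+q≡N IH =
      ≡.subst (λ N → ⟦ suc N ⟧ * c (suc r) q ≈ ⟦ suc r ⟧ * (φ ^ᴾ suc N) q) (≡.sym r+q≡N) (cancel e (begin
        ⟦ N ⟧ * (⟦ suc N ⟧ * c (suc r) q)
          ≈⟨ x∙yz≈y∙xz _ _ _ ⟩
        ⟦ suc N ⟧ * (⟦ N ⟧ * c (suc r) q)
          ≈⟨ *-congˡ (*-congˡ (c-suc r q)) ⟩
        ⟦ suc N ⟧ * (⟦ N ⟧ * anti (λ d q′ → φ d * c (r ℕ.+ d) q′) q)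
          ≈⟨ *-congˡ (trans (*-anti q _ _) (anti-cong q step)) ⟩
        ⟦ suc N ⟧ * anti (λ d q′ → ⟦ r ⟧ * (φ d * (φ ^ᴾ N) q′) + ⟦ d ⟧ * φ d * (φ ^ᴾ N) q′) q
          ≈⟨ *-congˡ (trans (anti-+ q _ _) (+-congʳ (sym (*-anti q _ _)))) ⟩
        ⟦ suc N ⟧ * (⟦ r ⟧ * X + (D φ ⊗ φ ^ᴾ N) q)
          ≈⟨ distribˡ _ _ _ ⟩
        ⟦ suc N ⟧ * (⟦ r ⟧ * X) + ⟦ suc N ⟧ * (D φ ⊗ φ ^ᴾ N) q
          ≈⟨ +-cong (trans (sym (*-assoc _ _ _)) (*-congʳ (sym (⟦⟧-homo-* (suc N) r))))
               (sym (trans (D-^ φ N q) (×ᴾ-coeff (suc N) (D φ ⊗ φ ^ᴾ N) q))) ⟩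
        ⟦ suc N ℕ.* r ⟧ * X + ⟦ q ⟧ * X
          ≈⟨ distribʳ _ _ _ ⟨
        (⟦ suc N ℕ.* r ⟧ + ⟦ q ⟧) * X
          ≈⟨ *-congʳ (⟦⟧-homo-+ (suc N ℕ.* r) q) ⟨
        ⟦ suc N ℕ.* r ℕ.+ q ⟧ * X
          ≡⟨ ≡.cong (λ m → ⟦ m ⟧ * X) arith ⟩
        ⟦ N ℕ.* suc r ⟧ * X
          ≈⟨ trans (*-congʳ (⟦⟧-homo-* N (suc r))) (*-assoc _ _ _) ⟩
        ⟦ N ⟧ * (⟦ suc r ⟧ * X) ∎))
      where
      N = suc e
      X = (φ ^ᴾ suc N) q
      arith : suc N ℕ.* r ℕ.+ q ≡ N ℕ.* suc r
      arith = ≡.trans (ℕ-xy∙z≈xz∙y r (N ℕ.* r) q)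
        (≡.trans (≡.cong (ℕ._+ N ℕ.* r) r+q≡N) (≡.sym (ℕ.*-suc N r)))
      step : ∀ d q′ → d ℕ.+ q′ ≡ q → ⟦ N ⟧ * (φ d * c (r ℕ.+ d) q′) ≈
             ⟦ r ⟧ * (φ d * (φ ^ᴾ N) q′) + ⟦ d ⟧ * φ d * (φ ^ᴾ N) q′
      step d q′ d+q′≡q = begin
        ⟦ N ⟧ * (φ d * c (r ℕ.+ d) q′)
          ≈⟨ x∙yz≈y∙xz _ _ _ ⟩
        φ d * (⟦ N ⟧ * c (r ℕ.+ d) q′)
          ≈⟨ *-congˡ (≡.subst (λ M → ⟦ M ⟧ * c (r ℕ.+ d) q′ ≈ ⟦ r ℕ.+ d ⟧ * (φ ^ᴾ M) q′) size
               (IH d q′ d+q′≡q)) ⟩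
        φ d * (⟦ r ℕ.+ d ⟧ * (φ ^ᴾ N) q′)
          ≈⟨ x∙yz≈y∙xz _ _ _ ⟩
        ⟦ r ℕ.+ d ⟧ * (φ d * (φ ^ᴾ N) q′)
          ≈⟨ trans (*-congʳ (⟦⟧-homo-+ r d)) (distribʳ _ _ _) ⟩
        ⟦ r ⟧ * (φ d * (φ ^ᴾ N) q′) + ⟦ d ⟧ * (φ d * (φ ^ᴾ N) q′)
          ≈⟨ +-congˡ (*-assoc _ _ _) ⟨
        ⟦ r ⟧ * (φ d * (φ ^ᴾ N) q′) + ⟦ d ⟧ * φ d * (φ ^ᴾ N) q′ ∎
        where
        size : r ℕ.+ d ℕ.+ q′ ≡ N
        size = ≡.trans (ℕ.+-assoc r d q′) (≡.trans (≡.cong (r ℕ.+_) d+q′≡q) r+q≡N)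

    lagrange : ∀ r q → Lagrange[ r , q ]
    lagrange r q = go (r ℕ.+ q) r q ≡.refl
      where
      go : ∀ e r q → r ℕ.+ q ≡ e → Lagrange[ r , q ]
      go e       zero    zero    _  = trans (zeroˡ _) (sym (zeroˡ _))
      go e       zero    (suc q) _  = trans (zeroʳ _) (sym (zeroˡ _))
      go (suc e) (suc r) q       eq = lagrange-suc e r q (ℕ.suc-injective eq)
        λ d q′ d+q′≡q → go e (r ℕ.+ d) q′ (≡.trans (ℕ.+-assoc r d q′)
          (≡.trans (≡.cong (r ℕ.+_) d+q′≡q) (ℕ.suc-injective eq)))

    -- Linearity reduces this to the powers y^m; the factor m supplied by `lagrange` turns H m into
    -- a coefficient of D H.
    lagrange-D : ∀ H n → ⟦ n ⟧ * anti (λ m q → H m * c m q) n ≈ (D H ⊗ φ ^ᴾ n) n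
    lagrange-D H n = trans (*-anti n _ _) (anti-cong n step)
      where
      step : ∀ m q → m ℕ.+ q ≡ n → ⟦ n ⟧ * (H m * c m q) ≈ ⟦ m ⟧ * H m * (φ ^ᴾ n) q
      step m q ≡.refl = trans (x∙yz≈y∙xz _ _ _)
        (trans (*-congˡ (lagrange m q)) (x∙yz≈yx∙z _ _ _))

  -- Blocks of k + 1 consecutive labels

  module Blocks (k : ℕ) (w : ℕ → ℕ → Carrier) (u : ℕ → Pow)
    (w-multiple : ∀ l m → w l (suc k ℕ.* m) ≈ u l m)
    (w-other    : ∀ l m i → 0 ℕ.< i → i ℕ.< suc k → w l (suc k ℕ.* m ℕ.+ i) ≈ 0#)
    where

    private κ = suc k

    -- For r consecutive vertices labelled from j on, the series of their numbers of children divided by κ.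
    window : ℕ → ℕ → Pow
    window j zero    = P.1#
    window j (suc r) = u j ⊗ window (suc j) r

    window-const : ∀ f r j → (∀ i → i ℕ.< r → u (i ℕ.+ j) ≋ f) → window j r ≋ f ^ᴾ r
    window-const f zero    j u≋f = P.refl
    window-const f (suc r) j u≋f = P.*-cong (u≋f 0 ℕ.z<s)
      (window-const f r (suc j) λ i i<r n →
        trans (reflexive (≡.cong (λ l → u l n) (ℕ.+-suc i j))) (u≋f (suc i) (ℕ.s<s i<r) n))

    window-last : ∀ r j → window j (suc r) ≋ window j r ⊗ u (r ℕ.+ j)
    window-last zero    j = P.*-comm (u j) P.1#
    window-last (suc r) j = P.trans (P.*-congˡ {u j} (window-last r (suc j)))
      (P.trans (P.sym (P.*-assoc (u j) _ _))
        (P.reflexive (≡.cong (λ l → window j (suc r) ⊗ u l) (ℕ.+-suc r j))))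

    multiples : ∀ s q j →
      anti (λ d q′ → w j d * forestWeight w (s ℕ.+ d) q′ (suc j)) (κ ℕ.* q) ≈
      anti (λ d q′ → u j d * forestWeight w (s ℕ.+ κ ℕ.* d) (κ ℕ.* q′) (suc j)) q
    multiples s q j = trans
      (anti-multiples κ q _ λ m i q′ 0<i i<κ → trans (*-congʳ (w-other j m i 0<i i<κ)) (zeroˡ _))
      (anti-cong q λ d q′ _ → *-congʳ (w-multiple j d))

    -- The next r vertices in pre-order are read, wherever they sit in the forest. Each removes one
    -- root and adds a multiple of κ, so r + κ * m roots never run out on the way and a multiple of
    -- κ remains.
    block : ∀ r m q j → forestWeight w (r ℕ.+ κ ℕ.* m) (κ ℕ.* q) j ≈
      anti (λ d q′ → window j r d * forestWeight w (κ ℕ.* (m ℕ.+ d)) (κ ℕ.* q′) (r ℕ.+ j)) q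
    block zero m q j = sym (trans (anti-const 1# q _) (trans (*-identityˡ _)
      (reflexive (≡.cong (λ x → forestWeight w (κ ℕ.* x) (κ ℕ.* q) j) (ℕ.+-identityʳ m)))))
    block (suc r) m q j = begin
      V (suc r ℕ.+ κ ℕ.* m) (κ ℕ.* q) j
        ≈⟨ trans (forestWeight-suc w (r ℕ.+ κ ℕ.* m) (κ ℕ.* q) j) (multiples (r ℕ.+ κ ℕ.* m) q j) ⟩
      anti (λ x z → u j x * V (r ℕ.+ κ ℕ.* m ℕ.+ κ ℕ.* x) (κ ℕ.* z) (suc j)) q
        ≈⟨ anti-cong q (λ x z _ → *-congˡ (trans
             (reflexive (≡.cong (λ s → V s (κ ℕ.* z) (suc j)) (roots x))) (block r (m ℕ.+ x) z (suc j)))) ⟩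
      anti (λ x z → u j x * anti (λ y q′ → window (suc j) r y *
                              V (κ ℕ.* (m ℕ.+ x ℕ.+ y)) (κ ℕ.* q′) (r ℕ.+ suc j)) z) q
        ≈⟨ anti-cong q (λ x z _ → trans (*-anti z _ _) (anti-cong z λ y q′ _ →
             trans (*-congˡ (*-congˡ (reflexive (≡.cong₂ (λ y l → V (κ ℕ.* y) (κ ℕ.* q′) l)
               (ℕ.+-assoc m x y) (ℕ.+-suc r j))))) (sym (*-assoc _ _ _)))) ⟩
      anti (λ x → anti (λ y q′ → u j x * window (suc j) r y *
                              V (κ ℕ.* (m ℕ.+ (x ℕ.+ y))) (κ ℕ.* q′) (suc r ℕ.+ j))) q
        ≈⟨ anti-assoc q _ ⟨
      anti (λ d q′ → anti (λ x y → u j x * window (suc j) r y *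
                              V (κ ℕ.* (m ℕ.+ (x ℕ.+ y))) (κ ℕ.* q′) (suc r ℕ.+ j)) d) q
        ≈⟨ anti-cong q (λ d q′ _ → trans (anti-cong d λ x y x+y≡d → *-congˡ
             (reflexive (≡.cong (λ y → V (κ ℕ.* (m ℕ.+ y)) (κ ℕ.* q′) (suc r ℕ.+ j)) x+y≡d)))
             (sym (anti-* d _ _))) ⟩
      anti (λ d q′ → window j (suc r) d * V (κ ℕ.* (m ℕ.+ d)) (κ ℕ.* q′) (suc r ℕ.+ j)) q ∎
      where
      V = forestWeight w
      roots : ∀ x → r ℕ.+ κ ℕ.* m ℕ.+ κ ℕ.* x ≡ r ℕ.+ κ ℕ.* (m ℕ.+ x)
      roots x = ≡.trans (ℕ.+-assoc r _ _) (≡.cong (r ℕ.+_) (≡.sym (ℕ.*-distribˡ-+ κ m x)))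

    module _ (w-periodic : ∀ l d → w (κ ℕ.+ l) d ≈ w l d) (φ : Pow)
      (cancel : ∀ n {x y} → ⟦ suc n ⟧ * x ≈ ⟦ suc n ⟧ * y → x ≈ y) where

      open Lagrange φ cancel using (c; c-unique)

      -- By `block` with r = κ, a block trades one group of κ roots for d groups with weight φ d,
      -- and periodicity brings the label back to j. This is the recurrence that `c-unique` asks
      -- for.
      forestWeight-multiples : ∀ j → window j κ ≋ φ →
        ∀ m q → forestWeight w (κ ℕ.* m) (κ ℕ.* q) j ≈ c m q
      forestWeight-multiples j window≋φ = c-unique g g-00 g-0s g-suc
        where
        g : ℕ → ℕ → Carrier
        g m q = forestWeight w (κ ℕ.* m) (κ ℕ.* q) j
        g-00 : g 0 0 ≈ 1#
        g-00 = reflexive (≡.cong₂ (λ x y → forestWeight w x y j) (ℕ.*-zeroʳ κ) (ℕ.*-zeroʳ κ))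
        g-0s : ∀ q → g 0 (suc q) ≈ 0#
        g-0s q = reflexive (≡.cong (λ x → forestWeight w x (κ ℕ.* suc q) j) (ℕ.*-zeroʳ κ))
        g-suc : ∀ m q → g (suc m) q ≈ anti (λ d q′ → φ d * g (m ℕ.+ d) q′) q
        g-suc m q = trans (reflexive (≡.cong (λ x → forestWeight w x (κ ℕ.* q) j) (ℕ.*-suc κ m)))
          (trans (block κ m q j) (anti-cong q λ d q′ _ → *-cong (window≋φ d)
            (forestWeight-relabel {w} {w} (κ ℕ.* (m ℕ.+ d)) (κ ℕ.* q′) (κ ℕ.+ j) j λ i d′ → trans
              (reflexive (≡.cong (λ l → w l d′) (ℕ.+-assoc κ j i))) (w-periodic (j ℕ.+ i) d′))))

      -- The root lies outside the blocks: it contributes the series `u j`, and the blocks start at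
      -- the label after it. The result is the coefficient of H(y) for H = `u j`.
      forestWeight-root : ∀ j → window (suc j) κ ≋ φ → ∀ n →
        anti (λ s q → w j s * forestWeight w s q (suc j)) (κ ℕ.* n) ≈
        anti (λ m q → u j m * c m q) n
      forestWeight-root j window≋φ n = trans (multiples 0 n j)
        (anti-cong n λ m q _ → *-congˡ (forestWeight-multiples (suc j) window≋φ m q))

-- Numbers and partitions

module Numbers where

  open import Data.Nat.Base hiding (_/_; _%_)
  open import Data.Nat.Properties
  open import Relation.Binary.PropositionalEquality

  -- The falling factorial a (a - 1) ⋯ (a - k + 1). For k > a a factor 0 occurs, so that `falling-+`
  -- and `C*!≡falling` hold without side conditions.
  falling : ℕ → ℕ → ℕ
  falling a zero    = 1
  falling a (suc k) = a * falling (pred a) k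

  falling-+ : ∀ a k l → falling a (k + l) ≡ falling a k * falling (a ∸ k) l
  falling-+ a zero    l = sym (+-identityʳ _)
  falling-+ a (suc k) l = begin
    a * falling (pred a) (k + l)                       ≡⟨ cong (a *_) (falling-+ (pred a) k l) ⟩
    a * (falling (pred a) k * falling (pred a ∸ k) l)  ≡⟨ *-assoc a _ _ ⟨
    falling a (suc k) * falling (pred a ∸ k) l
      ≡⟨ cong (λ b → falling a (suc k) * falling b l) (trans (cong (_∸ k) (pred[n]≡n∸1 {a})) (∸-+-assoc a 1 k)) ⟩
    falling a (suc k) * falling (a ∸ suc k) l          ∎
    where
    open ≡-Reasoning
    pred[n]≡n∸1 : ∀ {n} → pred n ≡ n ∸ 1
    pred[n]≡n∸1 {zero}  = refl
    pred[n]≡n∸1 {suc n} = refl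

  falling-suc : ∀ a k → falling a (suc k) + k * falling a k ≡ a * falling a k
  falling-suc a       zero    = +-identityʳ _
  falling-suc zero    (suc k) = *-zeroʳ (suc k)
  falling-suc (suc a) (suc k) = begin
    suc a * falling a (suc k) + suc k * (suc a * falling a k)
      ≡⟨ solve 4 (λ a k x y → (con 1 :+ a) :* x :+ (con 1 :+ k) :* ((con 1 :+ a) :* y) :=
                              (con 1 :+ a) :* (y :+ (x :+ k :* y))) refl a k (falling a (suc k)) (falling a k) ⟩
    suc a * (falling a k + (falling a (suc k) + k * falling a k))
      ≡⟨ cong (λ x → suc a * (falling a k + x)) (falling-suc a k) ⟩
    suc a * (suc a * falling a k) ∎
    where
    open ≡-Reasoning
    open +-*-Solver

  nC0≡1 : ∀ n → n C 0 ≡ 1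
  nC0≡1 n = trans (nCk≡nC[n∸k] {0} {n} z≤n) (nCn≡1 n)

  C*!≡falling : ∀ a k → (a C k) * k ! ≡ falling a k
  C*!≡falling a       zero    = cong (_* 1) (nC0≡1 a)
  C*!≡falling zero    (suc k) = cong (_* suc k !) (k>n⇒nCk≡0 {0} {suc k} z<s)
  C*!≡falling (suc a) (suc k) = begin
    (suc a C suc k) * suc k !                      ≡⟨ cong (_* suc k !) (nCk+nC[k+1]≡[n+1]C[k+1] a k) ⟨
    ((a C k) + (a C suc k)) * suc k !              ≡⟨ *-distribʳ-+ (suc k !) (a C k) (a C suc k) ⟩
    (a C k) * suc k ! + (a C suc k) * suc k !      ≡⟨ cong₂ _+_ shift (C*!≡falling a (suc k)) ⟩
    suc k * falling a k + falling a (suc k)        ≡⟨ +-assoc (falling a k) _ _ ⟩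
    falling a k + (k * falling a k + falling a (suc k)) ≡⟨ cong (falling a k +_) (+-comm (k * falling a k) _) ⟩
    falling a k + (falling a (suc k) + k * falling a k) ≡⟨ cong (falling a k +_) (falling-suc a k) ⟩
    suc a * falling a k                            ∎
    where
    open ≡-Reasoning
    shift : (a C k) * suc k ! ≡ suc k * falling a k
    shift = begin
      (a C k) * (suc k * k !) ≡⟨ *-assoc (a C k) (suc k) _ ⟨
      (a C k) * suc k * k !   ≡⟨ cong (_* k !) (*-comm (a C k) (suc k)) ⟩
      suc k * (a C k) * k !   ≡⟨ *-assoc (suc k) (a C k) _ ⟩
      suc k * ((a C k) * k !) ≡⟨ cong (suc k *_) (C*!≡falling a k) ⟩
      suc k * falling a k     ∎

  -- The vector (mₚ, …, m₁) stands for the partition with mᵢ parts equal to i.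
  partsOf : ∀ {p} → Vec ℕ p → List ℕ
  partsOf []                = []
  partsOf {suc p} (k ∷ v) = replicate k (suc p) ++ partsOf v

  partsOf-≤ : ∀ {p} (v : Vec ℕ p) → All (_≤ p) (partsOf v)
  partsOf-≤ []      = []
  partsOf-≤ (k ∷ v) = All.++⁺ (All.replicate⁺ k ≤-refl) (All.map m≤n⇒m≤1+n (partsOf-≤ v))

  partsOf-positive : ∀ {p} (v : Vec ℕ p) → All (0 <_) (partsOf v)
  partsOf-positive []      = []
  partsOf-positive (k ∷ v) = All.++⁺ (All.replicate⁺ k z<s) (partsOf-positive v)

  partsOf-decreasing : ∀ {p} (v : Vec ℕ p) → AllPairs _≥_ (partsOf v)
  partsOf-decreasing []          = []
  partsOf-decreasing (zero  ∷ v) = partsOf-decreasing v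
  partsOf-decreasing (suc k ∷ v) = partsOf-≤ (k ∷ v) ∷ partsOf-decreasing (k ∷ v)

  partitionOf : ∀ {p} → Vec ℕ p → Partition
  partitionOf v = mkPartition (partsOf v) (partsOf-positive v) (AllPairs⇒Linked (partsOf-decreasing v))

  partsOf-injective : ∀ {p} (v w : Vec ℕ p) → partsOf v ≡ partsOf w → v ≡ w
  partsOf-injective []          []          _  = refl
  partsOf-injective (zero  ∷ v) (zero  ∷ w) eq = cong (0 ∷_) (partsOf-injective v w eq)
  partsOf-injective (zero  ∷ v) (suc l ∷ w) eq =
    contradiction (All.head (subst (All (_≤ _)) eq (partsOf-≤ v))) 1+n≰n
  partsOf-injective (suc k ∷ v) (zero  ∷ w) eq =
    contradiction (All.head (subst (All (_≤ _)) (sym eq) (partsOf-≤ w))) 1+n≰n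
  partsOf-injective (suc k ∷ v) (suc l ∷ w) eq
    with refl ← partsOf-injective (k ∷ v) (l ∷ w) (List.∷-injectiveʳ eq) = refl

  -- Multiplicities up to M of the parts up to p. A product shape is chosen over the partitions of
  -- bounded size because sums over it follow the binomial theorem, one part size at a time.
  boxed : (M p : ℕ) → List (Vec ℕ p)
  boxed M zero    = [] ∷ []
  boxed M (suc p) = cartesianProductWith _∷_ (upTo (suc M)) (boxed M p)

  boxed-unique : ∀ M p → Unique (boxed M p)
  boxed-unique M zero    = [] ∷ []
  boxed-unique M (suc p) = Unique.cartesianProductWith⁺ _∷_ Vec.∷-injective
    (Unique.upTo⁺ (suc M)) (boxed-unique M p)

  split-maximal : ∀ p xs → AllPairs _≥_ xs → All (_≤ suc p) xs →
                  ∃ λ k → ∃ λ ys → xs ≡ replicate k (suc p) ++ ys × AllPairs _≥_ ys × All (_≤ p) ys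
  split-maximal p []       _          _          = 0 , [] , refl , [] , []
  split-maximal p (x ∷ xs) (x≥ ∷ dec) (x≤ ∷ xs≤) with x ≟ suc p
  ... | no x≢  = 0 , x ∷ xs , refl , x≥ ∷ dec , x≤p ∷ All.map (λ y≤x → ≤-trans y≤x x≤p) x≥
    where x≤p = s≤s⁻¹ (≤∧≢⇒< x≤ x≢)
  ... | yes refl with k , ys , refl , dec′ , ys≤ ← split-maximal p xs dec xs≤ =
    suc k , ys , refl , dec′ , ys≤

  boxed-complete : ∀ M p {xs} → All (0 <_) xs → AllPairs _≥_ xs → All (_≤ p) xs → length xs ≤ M →
                   ∃ λ v → v ∈ boxed M p × partsOf v ≡ xs
  boxed-complete M zero    {[]}    _        _   _        _     = [] , here refl , refl
  boxed-complete M zero    {_ ∷ _} (x> ∷ _) _   (x≤ ∷ _) _     = contradiction (≤-trans x> x≤) 1+n≰n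
  boxed-complete M (suc p) {xs}    xs>0     dec xs≤      |xs|≤M
    with k , ys , refl , dec′ , ys≤ ← split-maximal p xs dec xs≤
    with |xs| ← trans (List.length-++ (replicate k (suc p))) (cong (_+ length ys) (List.length-replicate k))
    with v , v∈ , refl ← boxed-complete M p (All.++⁻ʳ (replicate k (suc p)) xs>0) dec′ ys≤
           (≤-trans (m≤n+m _ k) (subst (_≤ M) |xs| |xs|≤M))
    = k ∷ v , ∈-cartesianProductWith⁺ _∷_ (∈-upTo⁺ (s≤s (≤-trans (m≤m+n k _) (subst (_≤ M) |xs| |xs|≤M)))) v∈ , refl

  All≤sum : ∀ xs → All (ℕ._≤ sum xs) xs
  All≤sum []       = []
  All≤sum (x ∷ xs) = m≤m+n x (sum xs) ∷ All.map (λ y≤ → ≤-trans y≤ (m≤n+m (sum xs) x)) (All≤sum xs)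

  length≤sum : ∀ {xs} → All (0 <_) xs → length xs ≤ sum xs
  length≤sum []         = z≤n
  length≤sum (x> ∷ xs>) = +-mono-≤ x> (length≤sum xs>)

  partitions : (M n : ℕ) → List Partition
  partitions M n = map partitionOf (boxed M n)

  partitionOf-injective : ∀ {p} (v w : Vec ℕ p) → partitionOf v ≡ partitionOf w → v ≡ w
  partitionOf-injective v w eq = partsOf-injective v w (cong parts {partitionOf v} {partitionOf w} eq)

  partitions-unique : ∀ M n → Unique (partitions M n)
  partitions-unique M n = Unique.map⁺ (λ {v} {w} → partitionOf-injective v w) (boxed-unique M n)

  parts-positive : ∀ ν → All (0 <_) (parts ν)
  parts-positive (mkPartition xs xs>0 _) = recompute (All.all? (0 <?_) xs) xs>0

  parts-decreasing : ∀ ν → AllPairs _≥_ (parts ν)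
  parts-decreasing (mkPartition xs _ dec) =
    Linked⇒AllPairs (λ x≥y y≥z → ≤-trans y≥z x≥y) (recompute (linked? _≥?_ xs) dec)

  parts-injective : ∀ {μ ν : Partition} → parts μ ≡ parts ν → μ ≡ ν
  parts-injective refl = refl

  partitions-complete : ∀ {M n} → n ≤ M → ∀ ν → ∣ ν ∣ₚ ≤ n → ν ∈ partitions M n
  partitions-complete {M} {n} n≤M ν |ν|≤n
    with v , v∈ , eq ← boxed-complete M n (parts-positive ν) (parts-decreasing ν)
           (All.map (λ x≤ → ≤-trans x≤ |ν|≤n) (All≤sum (parts ν)))
           (≤-trans (length≤sum (parts-positive ν)) (≤-trans |ν|≤n n≤M))
    = subst (_∈ partitions M n) (parts-injective {partitionOf v} {ν} eq) (∈-map⁺ partitionOf v∈)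

  -- Multiplicities and m_λ

  count : ℕ → List ℕ → ℕ
  count i xs = length (filter (_≟ i) xs)

  count-replicate : ∀ i k ys → count i (replicate k i ++ ys) ≡ k + count i ys
  count-replicate i zero    ys = refl
  count-replicate i (suc k) ys = trans
    (cong length (List.filter-accept (_≟ i) {i} {replicate k i ++ ys} refl)) (cong suc (count-replicate i k ys))

  count-replicate-≢ : ∀ {i x} → x ≢ i → ∀ k ys → count i (replicate k x ++ ys) ≡ count i ys
  count-replicate-≢         x≢i zero    ys = refl
  count-replicate-≢ {i} {x} x≢i (suc k) ys = trans
    (cong length (List.filter-reject (_≟ i) {x} {replicate k x ++ ys} x≢i)) (count-replicate-≢ x≢i k ys)

  count-< : ∀ {i xs} → All (_< i) xs → count i xs ≡ 0
  count-< {i} xs<i = cong length (List.filter-none (_≟ i) (All.map <⇒≢ xs<i))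

  factorials : ℕ → List ℕ → ℕ
  factorials P xs = product (map (λ i → count i xs !) (oneTo P))

  product-oneTo-suc : ∀ (f : ℕ → ℕ) P → product (map f (oneTo (suc P))) ≡ product (map f (oneTo P)) * f (suc P)
  product-oneTo-suc f P = begin
    product (map f (oneTo (suc P)))                 ≡⟨ cong (product ∘ map f) (List.applyUpTo-∷ʳ suc P) ⟨
    product (map f (oneTo P ++ suc P ∷ []))         ≡⟨ cong product (List.map-++ f (oneTo P) _) ⟩
    product (map f (oneTo P) ++ f (suc P) ∷ [])     ≡⟨ ListAction.product-++ (map f (oneTo P)) _ ⟩
    product (map f (oneTo P)) * (f (suc P) * 1)     ≡⟨ cong (product (map f (oneTo P)) *_) (*-identityʳ _) ⟩
    product (map f (oneTo P)) * f (suc P)           ∎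
    where open ≡-Reasoning

  factorials-+ : ∀ d P xs → All (_≤ P) xs → factorials (d + P) xs ≡ factorials P xs
  factorials-+ zero    P xs xs≤ = refl
  factorials-+ (suc d) P xs xs≤ = begin
    factorials (suc d + P) xs                            ≡⟨ product-oneTo-suc (λ i → count i xs !) (d + P) ⟩
    factorials (d + P) xs * count (suc d + P) xs !       ≡⟨ cong₂ (λ x c → x * c !) (factorials-+ d P xs xs≤)
                                                            (count-< (All.map (λ x≤ → s≤s (≤-trans x≤ (m≤n+m P d))) xs≤)) ⟩
    factorials P xs * 1                                  ≡⟨ *-identityʳ _ ⟩
    factorials P xs                                      ∎
    where open ≡-Reasoning

  -- Indices above all entries contribute 0! = 1, so both products agree with the one up to P + Q.
  -- This reconciles the range up to |λ| in `multFactorial` with the range up to p in an induction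
  -- on vectors.
  factorials-bound : ∀ {P Q xs} → All (_≤ P) xs → All (_≤ Q) xs → factorials P xs ≡ factorials Q xs
  factorials-bound {P} {Q} {xs} xs≤P xs≤Q = trans (sym (factorials-+ Q P xs xs≤P))
    (trans (cong (λ R → factorials R xs) (+-comm Q P)) (factorials-+ P Q xs xs≤Q))

  factorials-≢ : ∀ {P x} → P < x → ∀ k ys → factorials P (replicate k x ++ ys) ≡ factorials P ys
  factorials-≢ {zero}  P<x k ys = refl
  factorials-≢ {suc P} P<x k ys = trans (product-oneTo-suc _ P) (trans
    (cong₂ (λ a b → a * b !) (factorials-≢ (<-trans (n<1+n P) P<x) k ys) (count-replicate-≢ (<⇒≢ P<x ∘ sym) k ys))
    (sym (product-oneTo-suc _ P)))

  multFactorial-∷ : ∀ {p} k (v : Vec ℕ p) →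
    multFactorial (partitionOf (k ∷ v)) ≡ k ! * multFactorial (partitionOf v)
  multFactorial-∷ {p} k v = begin
    multFactorial (partitionOf (k ∷ v))
      ≡⟨ factorials-bound (All≤sum (partsOf (k ∷ v))) (partsOf-≤ (k ∷ v)) ⟩
    factorials (suc p) (partsOf (k ∷ v))
      ≡⟨ product-oneTo-suc _ p ⟩
    factorials p (partsOf (k ∷ v)) * count (suc p) (partsOf (k ∷ v)) !
      ≡⟨ cong₂ (λ a b → a * b !) (factorials-≢ {p} ≤-refl k (partsOf v)) (count-replicate (suc p) k (partsOf v)) ⟩
    factorials p (partsOf v) * (k + count (suc p) (partsOf v)) !
      ≡⟨ cong₂ (λ a b → a * (k + b) !) (factorials-bound (partsOf-≤ v) (All≤sum (partsOf v)))
           (count-< (All.map s≤s (partsOf-≤ v))) ⟩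
    multFactorial (partitionOf v) * (k + 0) !
      ≡⟨ trans (cong (λ k → multFactorial (partitionOf v) * k !) (+-identityʳ k)) (*-comm _ (k !)) ⟩
    k ! * multFactorial (partitionOf v) ∎
    where open ≡-Reasoning

  -- Fractions in ℚ are kept in lowest terms; on unnormalised fractions the identities below are
  -- cross-multiplications.
  toℚᵘ-/ : ∀ a b → toℚᵘ (pos a /ℚ suc b) ℚᵘ.≃ mkℚᵘ (pos a) b
  toℚᵘ-/ a b = ℚ.toℚᵘ-fromℚᵘ (mkℚᵘ (pos a) b)

  fromℕ-suc : ∀ n → fromℕ (suc n) ≡ 1ℚ +ℚ fromℕ n
  fromℕ-suc n = ℚ.toℚᵘ-injective (begin-equality
    toℚᵘ (fromℕ (suc n))             ≃⟨ toℚᵘ-/ (suc n) 0 ⟩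
    mkℚᵘ (pos (suc n)) 0                 ≃⟨ *≡* (cong (λ m → (pos 1 ℤ.+ m) ℤ.* pos 1) (sym (ℤ.*-identityʳ (pos n)))) ⟩
    mkℚᵘ (pos 1) 0 ℚᵘ.+ mkℚᵘ (pos n) 0   ≃⟨ ℚᵘ.+-congʳ (mkℚᵘ (pos 1) 0) (toℚᵘ-/ n 0) ⟨
    toℚᵘ 1ℚ ℚᵘ.+ toℚᵘ (fromℕ n)      ≃⟨ ℚ.toℚᵘ-homo-+ 1ℚ (fromℕ n) ⟨
    toℚᵘ (1ℚ +ℚ fromℕ n)             ∎)
    where open ℚᵘ.≤-Reasoning

  /-*-cancel : ∀ a b .{{_ : NonZero b}} → (pos a /ℚ b) *ℚ fromℕ b ≡ fromℕ a
  /-*-cancel a (suc b) = ℚ.toℚᵘ-injective (begin-equality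
    toℚᵘ ((pos a /ℚ suc b) *ℚ fromℕ (suc b))          ≃⟨ ℚ.toℚᵘ-homo-* (pos a /ℚ suc b) (fromℕ (suc b)) ⟩
    toℚᵘ (pos a /ℚ suc b) ℚᵘ.* toℚᵘ (fromℕ (suc b))   ≃⟨ ℚᵘ.*-cong (toℚᵘ-/ a b) (toℚᵘ-/ (suc b) 0) ⟩
    mkℚᵘ (pos a) b ℚᵘ.* mkℚᵘ (pos (suc b)) 0              ≃⟨ *≡* eq ⟩
    mkℚᵘ (pos a) 0                                    ≃⟨ toℚᵘ-/ a 0 ⟨
    toℚᵘ (fromℕ a)                                  ∎)
    where
    open ℚᵘ.≤-Reasoning
    eq : pos a ℤ.* pos (suc b) ℤ.* pos 1 ≡ pos a ℤ.* (pos (suc b) ℤ.* pos 1)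
    eq = ℤ.*-assoc (pos a) (pos (suc b)) (pos 1)

open Numbers

-- Valid trees

edgesᶠ-forests : ∀ f s → All (λ F → edgesᶠ F ≡ s) (forests f s)
edgesᶠ-forests zero    zero    = ≡.refl ∷ []
edgesᶠ-forests (suc f) zero    = ≡.refl ∷ []
edgesᶠ-forests zero    (suc s) = []
edgesᶠ-forests (suc f) (suc s) = All.concat⁺ (All.map⁺ (All.applyUpTo⁺₁ id (suc s) λ {i} i≤s →
  All.cartesianProductWith⁺ (≡.setoid _) (≡.setoid _) _ (forests f i) (forests f (s ∸ i))
    λ ts∈ us∈ → ≡.cong suc (≡.trans
      (≡.cong₂ ℕ._+_ (All.lookup (edgesᶠ-forests f i) ts∈) (All.lookup (edgesᶠ-forests f (s ∸ i)) us∈))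
      (ℕ.m+[n∸m]≡n (ℕ.s≤s⁻¹ i≤s)))))

mutual
  length-degrees : ∀ T → length (degrees T) ≡ suc (edges T)
  length-degrees (node ts) = ≡.cong suc (length-degreesᶠ ts)

  length-degreesᶠ : ∀ F → length (degreesᶠ F) ≡ edgesᶠ F
  length-degreesᶠ []       = ≡.refl
  length-degreesᶠ (t ∷ ts) = ≡.trans (List.length-++ (degrees t))
    (≡.cong₂ ℕ._+_ (length-degrees t) (length-degreesᶠ ts))

labelFrom-++ : ∀ j xs ys → labelFrom j (xs ++ ys) ≡ labelFrom j xs ++ labelFrom (j ℕ.+ length xs) ys
labelFrom-++ j []       ys = ≡.cong (λ l → labelFrom l ys) (≡.sym (ℕ.+-identityʳ j))
labelFrom-++ j (x ∷ xs) ys = ≡.cong ((j , x) ∷_) (≡.trans (labelFrom-++ (suc j) xs ys)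
  (≡.cong (λ l → labelFrom (suc j) xs ++ labelFrom l ys) (≡.sym (ℕ.+-suc j (length xs)))))

module TreeSums {a ℓ} (K : CommutativeRing a ℓ) (ι : ℚ → CommutativeRing.Carrier K)
  (t : ℕ → CommutativeRing.Carrier K) where

  open CommutativeRing K hiding (zero)
  open GeneratingFunctions K ι t using (∑; ∏; t^; treeSeries; A; B)
  open Series commutativeSemiring hiding (D; ⟦_⟧)
  open import Algebra.Properties.Semiring.Exp semiring using (_^_)
  open import Algebra.Properties.Semiring.Mult semiring using () renaming (_×_ to _×ᴷ_)
  open import Algebra.Properties.CommutativeSemigroup *-commutativeSemigroup
    using (x∙yz≈y∙xz; x∙yz≈yx∙z) renaming (interchange to *-interchange)
  open import Relation.Binary.Reasoning.Setoid setoid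

  ∑-cong-All : ∀ {X : Set} {f g : X → Carrier} {xs} → All (λ x → f x ≈ g x) xs → ∑ xs f ≈ ∑ xs g
  ∑-cong-All []         = refl
  ∑-cong-All (eq ∷ eqs) = +-cong eq (∑-cong-All eqs)

  ∑-cong : ∀ {X : Set} {f g : X → Carrier} xs → (∀ x → f x ≈ g x) → ∑ xs f ≈ ∑ xs g
  ∑-cong xs f≈g = ∑-cong-All (All.universal f≈g xs)

  ∑-++ : ∀ {X : Set} (f : X → Carrier) xs ys → ∑ (xs ++ ys) f ≈ ∑ xs f + ∑ ys f
  ∑-++ f []       ys = sym (+-identityˡ _)
  ∑-++ f (x ∷ xs) ys = trans (+-congˡ (∑-++ f xs ys)) (sym (+-assoc _ _ _))

  ∑-map : ∀ {X Y : Set} (h : X → Y) (f : Y → Carrier) xs → ∑ (map h xs) f ≡ ∑ xs (f ∘ h)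
  ∑-map h f xs = ≡.cong (foldr _+_ 0#) (≡.sym (List.map-∘ xs))

  *-∑ : ∀ {X : Set} x (f : X → Carrier) xs → x * ∑ xs f ≈ ∑ xs (λ y → x * f y)
  *-∑ x f []       = zeroʳ x
  *-∑ x f (y ∷ ys) = trans (distribˡ x _ _) (+-congˡ (*-∑ x f ys))

  ∑-* : ∀ {X : Set} x (f : X → Carrier) xs → ∑ xs f * x ≈ ∑ xs (λ y → f y * x)
  ∑-* x f []       = zeroˡ x
  ∑-* x f (y ∷ ys) = trans (distribʳ x _ _) (+-congˡ (∑-* x f ys))

  ∑-concatMap : ∀ {X Y : Set} (h : X → List Y) (f : Y → Carrier) xs →
                ∑ (concatMap h xs) f ≈ ∑ xs (λ x → ∑ (h x) f)
  ∑-concatMap h f []       = refl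
  ∑-concatMap h f (x ∷ xs) = trans (∑-++ f (h x) _) (+-congˡ (∑-concatMap h f xs))

  ∑-cartesianProductWith : ∀ {X Y Z : Set} (h : X → Y → Z) (f : Z → Carrier) xs ys →
    ∑ (cartesianProductWith h xs ys) f ≈ ∑ xs (λ x → ∑ ys (λ y → f (h x y)))
  ∑-cartesianProductWith h f []       ys = refl
  ∑-cartesianProductWith h f (x ∷ xs) ys = trans (∑-++ f (map (h x) ys) _)
    (+-cong (reflexive (∑-map (h x) f ys)) (∑-cartesianProductWith h f xs ys))

  ∑-applyUpTo : ∀ {X : Set} n (f : X → Carrier) (g : ℕ → X) →
                ∑ (applyUpTo g (suc n)) f ≈ anti (λ i _ → f (g i)) n
  ∑-applyUpTo zero    f g = +-identityʳ _
  ∑-applyUpTo (suc n) f g = +-congˡ (∑-applyUpTo n f (g ∘ suc))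

  ∑-upTo : ∀ n (h : ℕ → ℕ → Carrier) → ∑ (upTo (suc n)) (λ i → h i (n ∸ i)) ≈ anti h n
  ∑-upTo n h = trans (∑-applyUpTo n _ id) (anti-cong n λ i j i+j≡n →
    reflexive (≡.cong (h i) (≡.trans (≡.cong (_∸ i) (≡.sym i+j≡n)) (ℕ.m+n∸m≡n i j))))

  ∏-cong-All : ∀ {X : Set} {f g : X → Carrier} {xs} → All (λ x → f x ≈ g x) xs → ∏ xs f ≈ ∏ xs g
  ∏-cong-All []         = refl
  ∏-cong-All (eq ∷ eqs) = *-cong eq (∏-cong-All eqs)

  ∏-1 : ∀ {X : Set} {f : X → Carrier} {xs} → All (λ x → f x ≈ 1#) xs → ∏ xs f ≈ 1#
  ∏-1 []         = refl
  ∏-1 (eq ∷ eqs) = trans (*-cong eq (∏-1 eqs)) (*-identityˡ 1#)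

  ∏-++ : ∀ {X : Set} (f : X → Carrier) xs ys → ∏ (xs ++ ys) f ≈ ∏ xs f * ∏ ys f
  ∏-++ f []       ys = sym (*-identityˡ _)
  ∏-++ f (x ∷ xs) ys = trans (*-congˡ (∏-++ f xs ys)) (sym (*-assoc _ _ _))

  ∏-distrib-* : ∀ {X : Set} (f g : X → Carrier) xs → ∏ xs (λ x → f x * g x) ≈ ∏ xs f * ∏ xs g
  ∏-distrib-* f g []       = sym (*-identityˡ 1#)
  ∏-distrib-* f g (x ∷ xs) = trans (*-congˡ (∏-distrib-* f g xs)) (*-interchange _ _ _ _)

  ∏-↭ : ∀ {X : Set} (f : X → Carrier) {xs ys} → xs ↭ ys → ∏ xs f ≈ ∏ ys f
  ∏-↭ f ↭.refl            = refl
  ∏-↭ f (↭.prep x xs↭ys)    = *-congˡ (∏-↭ f xs↭ys)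
  ∏-↭ f (↭.swap x y xs↭ys)  = trans (x∙yz≈y∙xz _ _ _) (*-congˡ (*-congˡ (∏-↭ f xs↭ys)))
  ∏-↭ f (↭.trans xs↭ys ys↭zs) = trans (∏-↭ f xs↭ys) (∏-↭ f ys↭zs)

  -- Sums over plane forests

  forestProduct : (ℕ → ℕ → Carrier) → ℕ → List Tree → Carrier
  forestProduct w j F = ∏ (labelFrom j (degreesᶠ F)) (uncurry w)

  forestProduct-∷ : ∀ w j ts us → forestProduct w j (node ts ∷ us) ≈
    w j (length ts) * (forestProduct w (suc j) ts * forestProduct w (suc j ℕ.+ edgesᶠ ts) us)
  forestProduct-∷ w j ts us = *-congˡ (trans
    (reflexive (≡.trans
      (≡.cong (λ vs → ∏ vs (uncurry w)) (labelFrom-++ (suc j) (degreesᶠ ts) (degreesᶠ us)))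
      (≡.cong (λ e → ∏ (labelFrom (suc j) (degreesᶠ ts) ++ labelFrom (suc j ℕ.+ e) (degreesᶠ us)) (uncurry w))
        (length-degreesᶠ ts))))
    (∏-++ _ (labelFrom (suc j) (degreesᶠ ts)) _))

  -- The factor g of the number of roots makes the induction close: for the children of the first
  -- root it becomes the weight `w j` of that root, for the remaining trees `g ∘ suc`. The
  -- enumeration splits off the first tree while `forestWeight` reads one vertex; `forestWeight-+`
  -- reconciles the two.
  ∑-forests : ∀ w f e → e ℕ.≤ f → ∀ g j →
    ∑ (forests f e) (λ F → g (length F) * forestProduct w j F) ≈
    anti (λ s q → g s * forestWeight w s q j) e
  ∑-forests w f       zero    _         g j = +-identityʳ _
  ∑-forests w (suc f) (suc e) (ℕ.s≤s e≤f) g j = begin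
    ∑ (concatMap first (upTo (suc e))) G
      ≈⟨ trans (∑-concatMap first G (upTo (suc e))) (∑-cong (upTo (suc e)) λ i →
           ∑-cartesianProductWith (λ ts us → node ts ∷ us) G (forests f i) (forests f (e ∸ i))) ⟩
    ∑ (upTo (suc e)) (λ i → ∑ (forests f i) (λ ts → ∑ (forests f (e ∸ i)) (λ us →
      g (suc (length us)) * W j (node ts ∷ us))))
      ≈⟨ ∑-upTo e (λ i i′ → ∑ (forests f i) (λ ts → ∑ (forests f i′) (λ us →
           g (suc (length us)) * W j (node ts ∷ us)))) ⟩
    anti (λ i i′ → ∑ (forests f i) (λ ts → ∑ (forests f i′) (λ us →
      g (suc (length us)) * W j (node ts ∷ us)))) e
      ≈⟨ anti-cong e factor ⟩
    anti (λ i i′ → anti (λ d q₁ → w j d * V d q₁ (suc j)) i *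
                   anti (λ s q₂ → g (suc s) * V s q₂ (suc j ℕ.+ i)) i′) e
      -- The first tree has i = d + q₁ vertices below its root; written this way, the label of the
      -- next tree has the form found in `forestWeight-+`.
      ≈⟨ anti-cong e (λ i i′ _ → trans (anti-* i _ _) (anti-cong i λ d q₁ d+q₁≡i →
           trans (*-anti i′ _ _) (anti-cong i′ λ s q₂ _ → trans
             (*-congˡ (*-congˡ (reflexive (≡.cong (λ i → V s q₂ (suc j ℕ.+ i)) (≡.sym d+q₁≡i)))))
             (*-interchange _ _ _ _)))) ⟩
    anti (λ i i′ → anti (λ d q₁ → anti (λ s q₂ → w j d * g (suc s) * (V d q₁ (suc j) * V s q₂ (suc j ℕ.+ (d ℕ.+ q₁)))) i′) i) e
      ≈⟨ anti-interchange e _ ⟩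
    anti (λ r q → anti (λ d s → anti (λ q₁ q₂ → w j d * g (suc s) * (V d q₁ (suc j) * V s q₂ (suc j ℕ.+ (d ℕ.+ q₁)))) q) r) e
      ≈⟨ anti-cong e (λ r q _ → anti-cong r λ d s _ → trans (sym (*-anti q _ _))
           (*-congˡ (sym (forestWeight-+ w d s q (suc j))))) ⟩
    anti (λ r q → anti (λ d s → w j d * g (suc s) * V (d ℕ.+ s) q (suc j)) r) e
      ≈⟨ anti-assoc e (λ d s q → w j d * g (suc s) * V (d ℕ.+ s) q (suc j)) ⟩
    anti (λ d → anti (λ s q → w j d * g (suc s) * V (d ℕ.+ s) q (suc j))) e
      ≈⟨ anti-swap e _ ⟩
    anti (λ s → anti (λ d q → w j d * g (suc s) * V (d ℕ.+ s) q (suc j))) e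
      ≈⟨ anti-cong e (λ s q _ → trans (*-congˡ (forestWeight-suc w s q j)) (trans (*-anti q _ _)
           (anti-cong q λ d q′ _ → trans (x∙yz≈yx∙z _ _ _)
             (*-congˡ (reflexive (≡.cong (λ r → V r q′ (suc j)) (ℕ.+-comm s d))))))) ⟨
    anti (λ s q → g (suc s) * V (suc s) q j) e
      -- The added term s = 0 is zero, as a forest without roots has no vertices.
      ≈⟨ trans (+-congʳ (zeroʳ (g 0))) (+-identityˡ _) ⟨
    anti (λ s q → g s * V s q j) (suc e) ∎
    where
    W = forestProduct w
    V = forestWeight w
    G : List Tree → Carrier
    G F = g (length F) * W j F
    first : ℕ → List (List Tree)
    first i = cartesianProductWith (λ ts us → node ts ∷ us) (forests f i) (forests f (e ∸ i))
    factor : ∀ i i′ → i ℕ.+ i′ ≡ e →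
      ∑ (forests f i) (λ ts → ∑ (forests f i′) (λ us → g (suc (length us)) * W j (node ts ∷ us))) ≈
      anti (λ d q₁ → w j d * V d q₁ (suc j)) i * anti (λ s q₂ → g (suc s) * V s q₂ (suc j ℕ.+ i)) i′
    factor i i′ ≡.refl = begin
      ∑ (forests f i) (λ ts → ∑ (forests f i′) (λ us → g (suc (length us)) * W j (node ts ∷ us)))
        ≈⟨ ∑-cong-All (All.map (λ {ts} edges≡i → ∑-cong (forests f i′) λ us → split ts us edges≡i) (edgesᶠ-forests f i)) ⟩
      ∑ (forests f i) (λ ts → ∑ (forests f i′) (λ us →
        w j (length ts) * W (suc j) ts * (g (suc (length us)) * W (suc j ℕ.+ i) us)))
        ≈⟨ ∑-cong (forests f i) (λ ts → sym (*-∑ _ _ (forests f i′))) ⟩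
      ∑ (forests f i) (λ ts → w j (length ts) * W (suc j) ts *
        ∑ (forests f i′) (λ us → g (suc (length us)) * W (suc j ℕ.+ i) us))
        ≈⟨ ∑-* _ _ (forests f i) ⟨
      ∑ (forests f i) (λ ts → w j (length ts) * W (suc j) ts) *
        ∑ (forests f i′) (λ us → g (suc (length us)) * W (suc j ℕ.+ i) us)
        ≈⟨ *-cong (∑-forests w f i (ℕ.≤-trans (ℕ.m≤m+n i i′) e≤f) (w j) (suc j))
             (∑-forests w f i′ (ℕ.≤-trans (ℕ.m≤n+m i′ i) e≤f) (g ∘ suc) (suc j ℕ.+ i)) ⟩
      anti (λ d q₁ → w j d * V d q₁ (suc j)) i * anti (λ s q₂ → g (suc s) * V s q₂ (suc j ℕ.+ i)) i′ ∎
      where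
      split : ∀ ts us → edgesᶠ ts ≡ i → g (suc (length us)) * W j (node ts ∷ us) ≈
              w j (length ts) * W (suc j) ts * (g (suc (length us)) * W (suc j ℕ.+ i) us)
      split ts us ≡.refl = trans (*-congˡ (forestProduct-∷ w j ts us)) (trans (x∙yz≈y∙xz _ _ _)
        (trans (*-congˡ (x∙yz≈y∙xz _ _ _)) (sym (*-assoc _ _ _))))

  -- The monomial of a type

  T : Pow
  T zero    = 1#
  T (suc m) = t (suc m)

  factor : ℕ → ℕ → Carrier
  factor x i = if does (x ℕ.≟ i) then t i else 1#

  ^-count-∷ : ∀ i x xs → t i ^ count i (x ∷ xs) ≈ factor x i * t i ^ count i xs
  ^-count-∷ i x xs with does (x ℕ.≟ i)
  ... | true  = refl
  ... | false = sym (*-identityˡ _)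

  factor-≢ : ∀ {x i} → x ≢ i → factor x i ≡ 1#
  factor-≢ {x} {i} x≢i rewrite dec-false (x ℕ.≟ i) x≢i = ≡.refl

  ∏-factor : ∀ x M → x ℕ.≤ M → ∏ (oneTo M) (factor x) ≈ T x
  ∏-factor zero    M       _   = ∏-1 (All.applyUpTo⁺₁ suc M λ _ → refl)
  ∏-factor (suc x) (suc M) x≤M = begin
    ∏ (oneTo (suc M)) (factor (suc x))
      ≡⟨ ≡.cong (λ is → ∏ is (factor (suc x))) (List.applyUpTo-∷ʳ suc M) ⟨
    ∏ (oneTo M ++ suc M ∷ []) (factor (suc x))
      ≈⟨ ∏-++ _ (oneTo M) _ ⟩
    ∏ (oneTo M) (factor (suc x)) * (factor (suc x) (suc M) * 1#)
      ≈⟨ last (x ℕ.≟ M) ⟩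
    t (suc x) ∎
    where
    last : Dec (x ≡ M) → ∏ (oneTo M) (factor (suc x)) * (factor (suc x) (suc M) * 1#) ≈ t (suc x)
    last (yes ≡.refl) = begin
      ∏ (oneTo x) (factor (suc x)) * (factor (suc x) (suc x) * 1#)
        ≈⟨ *-cong (∏-1 (All.applyUpTo⁺₁ suc x λ i<x → reflexive (factor-≢ (ℕ.<⇒≢ (ℕ.s<s i<x) ∘ ≡.sym))))
             (trans (*-identityʳ _) (reflexive
               (≡.cong (if_then t (suc x) else 1#) (dec-true (suc x ℕ.≟ suc x) ≡.refl)))) ⟩
      1# * t (suc x)
        ≈⟨ *-identityˡ _ ⟩
      t (suc x) ∎
    last (no x≢M) = begin
      ∏ (oneTo M) (factor (suc x)) * (factor (suc x) (suc M) * 1#)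
        ≈⟨ *-cong (∏-factor (suc x) M (ℕ.≤∧≢⇒< (ℕ.s≤s⁻¹ x≤M) x≢M))
             (trans (*-identityʳ _) (reflexive (factor-≢ (x≢M ∘ ℕ.suc-injective)))) ⟩
      t (suc x) * 1#
        ≈⟨ *-identityʳ _ ⟩
      t (suc x) ∎

  -- A product over part sizes is exchanged for a product over the entries of the list, since each
  -- entry x contributes t x at exactly one index, or at none when x = 0.
  ∏-^-count : ∀ {M xs} → All (ℕ._≤ M) xs → ∏ (oneTo M) (λ i → t i ^ count i xs) ≈ ∏ xs T
  ∏-^-count {M} []                 = ∏-1 (All.universal (λ _ → refl) (oneTo M))
  ∏-^-count {M} {x ∷ xs} (x≤ ∷ xs≤) = begin
    ∏ (oneTo M) (λ i → t i ^ count i (x ∷ xs))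
      ≈⟨ ∏-cong-All (All.universal (λ i → ^-count-∷ i x xs) (oneTo M)) ⟩
    ∏ (oneTo M) (λ i → factor x i * t i ^ count i xs)
      ≈⟨ ∏-distrib-* _ _ (oneTo M) ⟩
    ∏ (oneTo M) (factor x) * ∏ (oneTo M) (λ i → t i ^ count i xs)
      ≈⟨ *-cong (∏-factor x M x≤) (∏-^-count xs≤) ⟩
    T x * ∏ xs T ∎

  t^-parts : ∀ ν → t^ ν ≈ ∏ (parts ν) T
  t^-parts ν = ∏-^-count (All≤sum (parts ν))

  ∏-T-positive : ∀ xs → ∏ (filter (0 ℕ.<?_) xs) T ≈ ∏ xs T
  ∏-T-positive []           = refl
  ∏-T-positive (zero  ∷ xs) = trans (∏-T-positive xs) (sym (*-identityˡ _))
  ∏-T-positive (suc x ∷ xs) = *-congˡ (∏-T-positive xs)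

  -- Sorting permutes the factors, and the discarded zeros are harmless because T has constant term
  -- 1. The monomial of a tree thus becomes a product over its vertices.
  t^-toPartition : ∀ xs → t^ (toPartition xs) ≈ ∏ xs T
  t^-toPartition xs = trans (t^-parts (toPartition xs))
    (trans (∏-↭ T (sort-↭ (filter (0 ℕ.<?_) xs))) (∏-T-positive xs))

  -- The factor 1 + y: a vertex with label congruent to 1 has no children or one group of k + 1, and
  -- leaves no part in the type.
  β : Pow
  β 0             = 1#
  β 1             = 1#
  β (suc (suc _)) = 0#

  -- Extends the sum over valid trees to all plane trees, on which the weight of an invalid tree is
  -- zero.
  ∑-filter : ∀ {X : Set} {Q : Pred X 0ℓ} (Q? : Decidable Q) {f g : X → Carrier} →
    (∀ x → Q x → f x ≈ g x) → (∀ x → ¬ Q x → g x ≈ 0#) → ∀ xs → ∑ (filter Q? xs) f ≈ ∑ xs g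
  ∑-filter Q? f≈g g≈0 [] = refl
  ∑-filter Q? f≈g g≈0 (x ∷ xs) with Q? x
  ... | yes q = +-cong (f≈g x q) (∑-filter Q? f≈g g≈0 xs)
  ... | no ¬q = trans (∑-filter Q? f≈g g≈0 xs) (sym (trans (+-congʳ (g≈0 x ¬q)) (+-identityˡ _)))

  -- Validity as a product of local weights

  module ValidTrees (k : ℕ) (1≤k : 1 ℕ.≤ k) where

    private κ = suc k

    vertexSeries : ℕ → Pow
    vertexSeries l = if does (l % κ ℕ.≟ 1 % κ) then β else T

    -- Chosen so that the product over all vertices is the monomial of the type for a valid tree and
    -- 0 for any other: see `∏-valid` and `∏-invalid`.
    vertexWeight : ℕ → ℕ → Carrier
    vertexWeight l d = if does (κ ∣? d) then vertexSeries l (d / κ) else 0#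

    vertexSeries-1 : ∀ l → l % κ ≡ 1 % κ → vertexSeries l ≡ β
    vertexSeries-1 l l≡1 = ≡.cong (if_then β else T) (dec-true (l % κ ℕ.≟ 1 % κ) l≡1)

    vertexSeries-≢1 : ∀ l → l % κ ≢ 1 % κ → vertexSeries l ≡ T
    vertexSeries-≢1 l l≢1 = ≡.cong (if_then β else T) (dec-false (l % κ ℕ.≟ 1 % κ) l≢1)

    vertexWeight-∣ : ∀ l {d} → κ ∣ d → vertexWeight l d ≡ vertexSeries l (d / κ)
    vertexWeight-∣ l {d} κ∣d = ≡.cong (if_then vertexSeries l (d / κ) else 0#) (dec-true (κ ∣? d) κ∣d)

    vertexWeight-∤ : ∀ l {d} → ¬ κ ∣ d → vertexWeight l d ≡ 0#
    vertexWeight-∤ l {d} κ∤d = ≡.cong (if_then vertexSeries l (d / κ) else 0#) (dec-false (κ ∣? d) κ∤d)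

    vertexWeight-* : ∀ l m → vertexWeight l (κ ℕ.* m) ≡ vertexSeries l m
    vertexWeight-* l m = ≡.trans (vertexWeight-∣ l (m∣m*n m))
      (≡.cong (vertexSeries l) (≡.trans (≡.cong (_/ κ) (ℕ.*-comm κ m)) (ℕ.m*n/n≡m m κ)))

    vertexWeight-other : ∀ l m i → 0 ℕ.< i → i ℕ.< κ → vertexWeight l (κ ℕ.* m ℕ.+ i) ≡ 0#
    vertexWeight-other l m i@(suc _) _ i<κ = vertexWeight-∤ l λ κ∣ →
      >⇒∤ i<κ (∣m+n∣m⇒∣n κ∣ (m∣m*n m))

    vertexWeight-periodic : ∀ l d → vertexWeight (κ ℕ.+ l) d ≡ vertexWeight l d
    vertexWeight-periodic l d = ≡.cong
      (λ r → if does (κ ∣? d) then (if does (r ℕ.≟ 1 % κ) then β else T) (d / κ) else 0#)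
      (≡.trans (≡.cong (_% κ) (ℕ.+-comm κ l)) (ℕ.[m+n]%n≡m%n l κ))

    childBlocks : List (ℕ × ℕ) → List ℕ
    childBlocks vs = map (λ v → proj₂ v / κ) (filter (¬? ∘ label≡1? k) vs)

    ∏-valid : ∀ {vs} → All (ValidVertex k) vs → ∏ (childBlocks vs) T ≈ ∏ vs (uncurry vertexWeight)
    ∏-valid [] = refl
    ∏-valid {(l , d) ∷ vs} ((at1 , off1) ∷ valid) = split (label≡1? k (l , d))
      where
      childBlocks-of : ∀ {us} → filter (¬? ∘ label≡1? k) ((l , d) ∷ vs) ≡ us →
        ∏ (childBlocks ((l , d) ∷ vs)) T ≈ ∏ (map (λ v → proj₂ v / κ) us) T
      childBlocks-of eq = reflexive (≡.cong (λ us → ∏ (map (λ v → proj₂ v / κ) us) T) eq)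

      weight≈1 : l % κ ≡ 1 % κ → d ≡ 0 ⊎ d ≡ κ → vertexWeight l d ≈ 1#
      weight≈1 l≡1 (inj₁ d≡0) = reflexive (≡.trans
        (≡.cong (vertexWeight l) (≡.trans d≡0 (≡.sym (ℕ.*-zeroʳ κ))))
        (≡.trans (vertexWeight-* l 0) (≡.cong (λ f → f 0) (vertexSeries-1 l l≡1))))
      weight≈1 l≡1 (inj₂ d≡κ) = reflexive (≡.trans
        (≡.cong (vertexWeight l) (≡.trans d≡κ (≡.sym (ℕ.*-identityʳ κ))))
        (≡.trans (vertexWeight-* l 1) (≡.cong (λ f → f 1) (vertexSeries-1 l l≡1))))

      split : Dec (Label≡1 k (l , d)) →
        ∏ (childBlocks ((l , d) ∷ vs)) T ≈ vertexWeight l d * ∏ vs (uncurry vertexWeight)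
      split (yes l≡1) = trans (childBlocks-of (List.filter-reject (¬? ∘ label≡1? k) {l , d} {vs} (λ l≢1 → l≢1 l≡1)))
        (trans (∏-valid valid) (sym (trans (*-congʳ (weight≈1 l≡1 (at1 l≡1))) (*-identityˡ _))))
      split (no l≢1) = trans (childBlocks-of (List.filter-accept (¬? ∘ label≡1? k) {l , d} {vs} l≢1))
        (*-cong (reflexive (≡.sym (≡.trans (vertexWeight-∣ l (off1 l≢1))
          (≡.cong (λ f → f (d / κ)) (vertexSeries-≢1 l l≢1))))) (∏-valid valid))

    vertexWeight-invalid : ∀ l d → ¬ ValidVertex k (l , d) → vertexWeight l d ≈ 0#
    vertexWeight-invalid l d ¬valid = split (label≡1? k (l , d)) (κ ∣? d)
      where
      split : Dec (Label≡1 k (l , d)) → Dec (κ ∣ d) → vertexWeight l d ≈ 0#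
      split _         (no κ∤d)  = reflexive (vertexWeight-∤ l κ∤d)
      split (no l≢1)  (yes κ∣d) = contradiction ((λ l≡1 → contradiction l≡1 l≢1) , λ _ → κ∣d) ¬valid
      split (yes l≡1) (yes (divides 0 d≡)) =
        contradiction ((λ _ → inj₁ d≡) , contradiction l≡1) ¬valid
      split (yes l≡1) (yes (divides 1 d≡)) =
        contradiction ((λ _ → inj₂ (≡.trans d≡ (ℕ.*-identityˡ κ))) , contradiction l≡1) ¬valid
      split (yes l≡1) (yes (divides q@(suc (suc _)) d≡)) = reflexive (≡.trans
        (≡.cong (vertexWeight l) (≡.trans d≡ (ℕ.*-comm q κ)))
        (≡.trans (vertexWeight-* l q) (≡.cong (λ f → f q) (vertexSeries-1 l l≡1))))

    ∏-invalid : ∀ vs → ¬ All (ValidVertex k) vs → ∏ vs (uncurry vertexWeight) ≈ 0#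
    ∏-invalid []             ¬valid = contradiction [] ¬valid
    ∏-invalid ((l , d) ∷ vs) ¬valid with validVertex? k (l , d)
    ... | yes v = trans (*-congˡ (∏-invalid vs λ vs-valid → ¬valid (v ∷ vs-valid))) (zeroʳ _)
    ... | no ¬v = trans (*-congʳ (vertexWeight-invalid l d ¬v)) (zeroˡ _)

    φ : Pow
    φ = T ^ᴾ k ⊗ β

    open Blocks k vertexWeight vertexSeries
      (λ l m → reflexive (vertexWeight-* l m)) (λ l m i 0<i i<κ → reflexive (vertexWeight-other l m i 0<i i<κ))

    window-2 : window 2 k ≋ T ^ᴾ k
    window-2 = window-const T k 2 λ i i<k n → reflexive (≡.cong (λ f → f n) (vertexSeries-≢1 (i ℕ.+ 2) (label≢1 i i<k)))
      where
      1%κ≡1 : 1 % κ ≡ 1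
      1%κ≡1 = ℕ.m<n⇒m%n≡m (ℕ.s<s 1≤k)
      label≢1 : ∀ i → i ℕ.< k → (i ℕ.+ 2) % κ ≢ 1 % κ
      -- Either i + 2 < κ, and the label is its own residue, or i + 2 = κ and the residue is 0.
      label≢1 i i<k eq with ℕ.m≤n⇒m<n∨m≡n i<k
      ... | inj₁ 1+i<k = case ≡.trans (≡.sym (ℕ.m<n⇒m%n≡m
              (≡.subst (ℕ._< κ) (ℕ.+-comm 2 i) (ℕ.s<s 1+i<k)))) (≡.trans eq 1%κ≡1) of λ i+2≡1 →
              ℕ.1+n≢0 (ℕ.suc-injective (≡.trans (ℕ.+-comm 2 i) i+2≡1))
      ... | inj₂ ≡.refl = ℕ.0≢1+n (≡.trans (≡.sym (ℕ.n%n≡0 κ))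
              (≡.trans (≡.cong (_% κ) (ℕ.+-comm 2 i)) (≡.trans eq 1%κ≡1)))

    window-1 : window 1 κ ≋ φ
    window-1 = P.trans (P.*-cong (P.reflexive (vertexSeries-1 1 ≡.refl)) window-2) (P.*-comm β (T ^ᴾ k))

    -- After a root labelled 1 the block has the labels 2, ..., k + 2 and β comes last; after a root
    -- labelled 0 it has 1, ..., k + 1 and β comes first. Commutativity makes φ the same, so A and B
    -- share one array `c`.
    window-2′ : window 2 κ ≋ φ
    window-2′ = P.trans (window-last k 2) (P.*-cong window-2
      (P.reflexive (vertexSeries-1 (k ℕ.+ 2) (≡.trans (≡.cong (_% κ) (ℕ.+-suc k 1))
        (≡.trans (≡.cong (λ x → suc x % κ) (ℕ.+-comm k 1)) (ℕ.[m+n]%n≡m%n 1 κ))))))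

    module _ (cancel : ∀ n {x y} → suc n ×ᴷ 1# * x ≈ suc n ×ᴷ 1# * y → x ≈ y) where

      open Lagrange φ cancel using (c)

      treeSeries-root : ∀ j n → window (suc j) κ ≋ φ →
        treeSeries k j n ≈ anti (λ m q → vertexSeries j m * c m q) n
      treeSeries-root j n window≋φ = begin
        ∑ (filter (valid? k j) (treesWith e)) (t^ ∘ type k j)
          ≈⟨ ∑-filter (valid? k j) (λ T valid → trans (t^-toPartition (childBlocks (vertices j T))) (∏-valid valid))
               (λ T → ∏-invalid (vertices j T)) (treesWith e) ⟩
        ∑ (treesWith e) (λ T → ∏ (vertices j T) (uncurry vertexWeight))
          ≡⟨ ∑-map node _ (forests e e) ⟩
        ∑ (forests e e) (λ F → vertexWeight j (length F) * forestProduct vertexWeight (suc j) F)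
          ≈⟨ ∑-forests vertexWeight e e ℕ.≤-refl (vertexWeight j) (suc j) ⟩
        anti (λ s q → vertexWeight j s * forestWeight vertexWeight s q (suc j)) e
          ≈⟨ forestWeight-root (λ l d → reflexive (vertexWeight-periodic l d)) φ cancel j window≋φ n ⟩
        anti (λ m q → vertexSeries j m * c m q) n ∎
        where e = κ ℕ.* n

      A-lagrange : ∀ n → A k n ≈ anti (λ m q → T m * c m q) n
      A-lagrange n = trans (treeSeries-root 0 n window-1)
        (anti-cong n λ m q _ → *-congʳ (reflexive (≡.cong (λ f → f m) (vertexSeries-≢1 0 0≢1))))
        where
        0≢1 : 0 % κ ≢ 1 % κ
        0≢1 eq = ℕ.0≢1+n (≡.trans eq (ℕ.m<n⇒m%n≡m (ℕ.s<s 1≤k)))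

      B-lagrange : ∀ n → B k n ≈ anti (λ m q → β m * c m q) n
      B-lagrange n = trans (treeSeries-root 1 n window-2′)
        (anti-cong n λ m q _ → *-congʳ (reflexive (≡.cong (λ f → f m) (vertexSeries-1 1 ≡.refl))))

-- Powers of T and extraction of coefficients

module Expansion {a ℓ} (K : CommutativeRing a ℓ) (ι : ℚ → CommutativeRing.Carrier K)
  (hom : RingMorphisms.IsRingHomomorphism +-*-rawRing (CommutativeRing.rawRing K) ι)
  (t : ℕ → CommutativeRing.Carrier K) where

  open CommutativeRing K hiding (zero)
  open GeneratingFunctions K ι t
  open Series commutativeSemiring
  open TreeSums K ι t
  open RingMorphisms.IsRingHomomorphism hom using (0#-homo; 1#-homo; +-homo; *-homo)
  open import Algebra.Properties.Semiring.Exp semiring using (_^_)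
  open import Algebra.Properties.CommutativeSemigroup *-commutativeSemigroup
    using (x∙yz≈y∙xz)
  open import Algebra.Properties.CommutativeSemigroup P.*-commutativeSemigroup
    using () renaming (x∙yz≈y∙xz to P-x∙yz≈y∙xz; interchange to P-interchange)
  open import Algebra.Properties.CommutativeSemigroup +-commutativeSemigroup
    using () renaming (interchange to +-interchange)
  open import Algebra.Solver.Ring.NaturalCoefficients.Default commutativeSemiring
    using (solve; _:*_; _:+_; _:=_)
  import Algebra.Properties.CommutativeSemiring.Binomial series as Binomial
  open import Algebra.Properties.Semiring.Sum P.semiring using () renaming (sum to sumᴾ)
  open import Relation.Binary.Reasoning.Setoid setoid

  ⟦⟧-cong : ∀ {m n} → m ≡ n → ⟦ m ⟧ ≈ ⟦ n ⟧
  ⟦⟧-cong m≡n = reflexive (≡.cong ⟦_⟧ m≡n)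

  ι-fromℕ : ∀ n → ι (fromℕ n) ≈ ⟦ n ⟧
  ι-fromℕ zero    = 0#-homo
  ι-fromℕ (suc n) = trans (reflexive (≡.cong ι (fromℕ-suc n)))
    (trans (+-homo _ _) (+-cong 1#-homo (ι-fromℕ n)))

  ι-/ : ∀ m n .{{_ : NonZero n}} → ⟦ n ⟧ * ι (pos m /ℚ n) ≈ ⟦ m ⟧
  ι-/ m n = begin
    ⟦ n ⟧ * ι (pos m /ℚ n)             ≈⟨ *-comm _ _ ⟩
    ι (pos m /ℚ n) * ⟦ n ⟧             ≈⟨ *-congˡ (ι-fromℕ n) ⟨
    ι (pos m /ℚ n) * ι (fromℕ n)       ≈⟨ *-homo _ _ ⟨
    ι ((pos m /ℚ n) *ℚ fromℕ n)        ≡⟨ ≡.cong ι (/-*-cancel m n) ⟩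
    ι (fromℕ m)                        ≈⟨ ι-fromℕ m ⟩
    ⟦ m ⟧                              ∎

  -- The image of 1/n under ι inverts n times 1 in K. This is the source of the factors 1/n and
  -- 1/(kn + 1), and of the cancellation in Lagrange inversion.
  ÷-intro : ∀ n .{{_ : NonZero n}} {x y} → ⟦ n ⟧ * x ≈ y → x ≈ ι (pos 1 /ℚ n) * y
  ÷-intro n {x} {y} nx≈y = begin
    x                             ≈⟨ *-identityˡ x ⟨
    1# * x                        ≈⟨ *-congʳ (trans (ι-/ 1 n) ⟦1⟧) ⟨
    ⟦ n ⟧ * ι (pos 1 /ℚ n) * x    ≈⟨ solve 3 (λ n i x → n :* i :* x := i :* (n :* x)) refl _ _ _ ⟩
    ι (pos 1 /ℚ n) * (⟦ n ⟧ * x)  ≈⟨ *-congˡ nx≈y ⟩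
    ι (pos 1 /ℚ n) * y            ∎

  ⟦⟧-cancel : ∀ n .{{_ : NonZero n}} {x y} → ⟦ n ⟧ * x ≈ ⟦ n ⟧ * y → x ≈ y
  ⟦⟧-cancel n nx≈ny = trans (÷-intro n nx≈ny) (sym (÷-intro n refl))

  ι-/-split : ∀ m n .{{_ : NonZero n}} → ι (pos m /ℚ n) ≈ ι (pos 1 /ℚ n) * ⟦ m ⟧
  ι-/-split m n = ÷-intro n (ι-/ m n)

  -- Monomials, powers of 1 + y and truncations of T

  mono : ℕ → Pow
  mono zero    = P.1#
  mono (suc q) zero    = 0#
  mono (suc q) (suc i) = mono q i

  mono-⊗-≥ : ∀ q f i → (mono q ⊗ f) (q ℕ.+ i) ≈ f i
  mono-⊗-≥ zero    f i = P.*-identityˡ f i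
  mono-⊗-≥ (suc q) f i = trans (+-congʳ (zeroˡ _)) (trans (+-identityˡ _) (mono-⊗-≥ q f i))

  mono-⊗-< : ∀ q f {n} → n ℕ.< q → (mono q ⊗ f) n ≈ 0#
  mono-⊗-< (suc q) f {zero}  _           = zeroˡ _
  mono-⊗-< (suc q) f {suc n} (ℕ.s≤s n<q) =
    trans (+-congʳ (zeroˡ _)) (trans (+-identityˡ _) (mono-⊗-< q f n<q))

  mono-⊗-mono : ∀ q r → mono q ⊗ mono r ≋ mono (q ℕ.+ r)
  mono-⊗-mono zero    r n       = P.*-identityˡ (mono r) n
  mono-⊗-mono (suc q) r zero    = zeroˡ _
  mono-⊗-mono (suc q) r (suc n) = trans (+-congʳ (zeroˡ _)) (trans (+-identityˡ _) (mono-⊗-mono q r n))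

  mono-^ : ∀ q k → mono q ^ᴾ k ≋ mono (k ℕ.* q)
  mono-^ q zero    = P.refl
  mono-^ q (suc k) = P.trans (P.*-congˡ {mono q} (mono-^ q k)) (mono-⊗-mono q (k ℕ.* q))

  mono-refl : ∀ q → mono q q ≈ 1#
  mono-refl zero    = refl
  mono-refl (suc q) = mono-refl q

  mono-≢ : ∀ q i → i ≢ q → mono q i ≈ 0#
  mono-≢ zero    zero    i≢q = contradiction ≡.refl i≢q
  mono-≢ zero    (suc i) i≢q = refl
  mono-≢ (suc q) zero    i≢q = refl
  mono-≢ (suc q) (suc i) i≢q = mono-≢ q i (i≢q ∘ ≡.cong suc)

  D-mono : ∀ q i → ⟦ i ⟧ * mono q i ≈ ⟦ q ⟧ * mono q i
  D-mono q i with i ℕ.≟ q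
  ... | yes ≡.refl = refl
  ... | no i≢q     = trans (vanish ⟦ i ⟧) (sym (vanish ⟦ q ⟧))
    where
    vanish : ∀ x → x * mono q i ≈ 0#
    vanish x = trans (*-congˡ (mono-≢ q i i≢q)) (zeroʳ x)

  const-⊗-const : ∀ x y → const x ⊗ const y ≋ const (x * y)
  const-⊗-const x y zero    = refl
  const-⊗-const x y (suc n) = trans (const-⊗ x (const y) (suc n)) (zeroʳ x)

  const-^ : ∀ x k → const x ^ᴾ k ≋ const (x ^ k)
  const-^ x zero    = P.refl
  const-^ x (suc k) = P.trans (P.*-congˡ {const x} (const-^ x k)) (const-⊗-const x (x ^ k))

  ⊗-∑ : ∀ {X : Set} f (y : X → Carrier) (g : X → Pow) xs →
    f ⊗ (λ i → ∑ xs (λ x → y x * g x i)) ≋ (λ i → ∑ xs (λ x → y x * (f ⊗ g x) i))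
  ⊗-∑ f y g []       i = P.zeroʳ f i
  ⊗-∑ f y g (x ∷ xs) i = trans (P.distribˡ f (λ i → y x * g x i) _ i)
    (+-cong (trans (anti-cong i λ _ _ _ → x∙yz≈y∙xz _ _ _) (sym (*-anti i _ _))) (⊗-∑ f y g xs i))

  β-⊗ : ∀ f n → (β ⊗ f) (suc n) ≈ f (suc n) + f n
  β-⊗ f n = +-cong (*-identityˡ _) (trans
    (anti-cong n λ { zero _ _ → refl ; (suc _) _ _ → refl }) (P.*-identityˡ f n))

  β-^ : ∀ n i → (β ^ᴾ n) i ≈ ⟦ n C i ⟧
  β-^ zero    zero    = sym ⟦1⟧
  β-^ zero    (suc i) = ⟦⟧-cong (≡.sym (k>n⇒nCk≡0 {0} {suc i} ℕ.z<s))
  β-^ (suc n) zero    = trans (*-identityˡ _) (trans (β-^ n 0)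
    (⟦⟧-cong (≡.trans (nC0≡1 n) (≡.sym (nC0≡1 (suc n))))))
  β-^ (suc n) (suc i) = begin
    (β ⊗ β ^ᴾ n) (suc i)             ≈⟨ β-⊗ (β ^ᴾ n) i ⟩
    (β ^ᴾ n) (suc i) + (β ^ᴾ n) i    ≈⟨ +-cong (β-^ n (suc i)) (β-^ n i) ⟩
    ⟦ n C suc i ⟧ + ⟦ n C i ⟧        ≈⟨ +-comm _ _ ⟩
    ⟦ n C i ⟧ + ⟦ n C suc i ⟧        ≈⟨ ⟦⟧-homo-+ (n C i) (n C suc i) ⟨
    ⟦ (n C i) ℕ.+ (n C suc i) ⟧      ≡⟨ ≡.cong ⟦_⟧ (nCk+nC[k+1]≡[n+1]C[k+1] n i) ⟩
    ⟦ suc n C suc i ⟧                ∎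

  -- The coefficient is C(s + n, n - q); by symmetry it is C(s + n, s + q), which is also right for
  -- q > n, where both sides vanish. The value s = 1 occurs only for AB, where an extra factor β
  -- raises the exponent to n + 1.
  mono-⊗-β^ : ∀ s q n → (mono q ⊗ β ^ᴾ (s ℕ.+ n)) n ≈ ⟦ (s ℕ.+ n) C (s ℕ.+ q) ⟧
  mono-⊗-β^ s q n with q ℕ.≤? n
  ... | no q≰n = trans (mono-⊗-< q (β ^ᴾ (s ℕ.+ n)) (ℕ.≰⇒> q≰n))
    (⟦⟧-cong (≡.sym (k>n⇒nCk≡0 (ℕ.+-monoʳ-< s (ℕ.≰⇒> q≰n)))))
  ... | yes q≤n with i , ≡.refl ← ℕ.m≤n⇒∃[o]m+o≡n q≤n = begin
    (mono q ⊗ β ^ᴾ b) (q ℕ.+ i)  ≈⟨ mono-⊗-≥ q (β ^ᴾ b) i ⟩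
    (β ^ᴾ b) i                   ≈⟨ β-^ b i ⟩
    ⟦ b C i ⟧                    ≡⟨ ≡.cong ⟦_⟧ (nCk≡nC[n∸k] i≤b) ⟩
    ⟦ b C (b ∸ i) ⟧              ≡⟨ ≡.cong (λ x → ⟦ b C x ⟧) b∸i≡s+q ⟩
    ⟦ b C (s ℕ.+ q) ⟧            ∎
    where
    b = s ℕ.+ (q ℕ.+ i)
    i≤b : i ℕ.≤ b
    i≤b = ℕ.≤-trans (ℕ.m≤n+m i q) (ℕ.m≤n+m _ s)
    b∸i≡s+q : b ∸ i ≡ s ℕ.+ q
    b∸i≡s+q = ≡.trans (≡.cong (_∸ i) (≡.sym (ℕ.+-assoc s q i))) (ℕ.m+n∸n≡m (s ℕ.+ q) i)

  D-β : D β ≋ mono 1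
  D-β 0             = zeroˡ _
  D-β 1             = trans (*-identityʳ _) ⟦1⟧
  D-β (suc (suc n)) = zeroʳ _

  -- The polynomial 1 + t₁ y + ⋯ + t_p y^p. It agrees with T up to degree p, and its powers unfold
  -- by the binomial theorem, largest part first.
  truncated : ℕ → Pow
  truncated zero    = P.1#
  truncated (suc p) = const (t (suc p)) ⊗ mono (suc p) ⊕ truncated p

  truncated-> : ∀ {p i} → p ℕ.< i → truncated p i ≈ 0#
  truncated-> {zero}  {suc i} _   = refl
  truncated-> {suc p} {i}     p<i = trans (+-cong
    (trans (const-⊗ _ (mono (suc p)) i) (trans (*-congˡ (mono-≢ (suc p) i (ℕ.<⇒≢ p<i ∘ ≡.sym))) (zeroʳ _)))
    (truncated-> (ℕ.<-trans (ℕ.n<1+n p) p<i))) (+-identityˡ 0#)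

  truncated-≤ : ∀ {p i} → i ℕ.≤ p → truncated p i ≈ T i
  truncated-≤ {zero}  {zero} _   = refl
  truncated-≤ {suc p} {i}    i≤p with i ℕ.≟ suc p
  ... | yes ≡.refl = trans (+-cong
      (trans (const-⊗ _ (mono (suc p)) (suc p)) (trans (*-congˡ (mono-refl p)) (*-identityʳ _)))
      (truncated-> {p} ℕ.≤-refl)) (+-identityʳ _)
  ... | no i≢ = trans (+-cong
      (trans (const-⊗ _ (mono (suc p)) i) (trans (*-congˡ (mono-≢ (suc p) i i≢)) (zeroʳ _)))
      (truncated-≤ (ℕ.s≤s⁻¹ (ℕ.≤∧≢⇒< i≤p i≢)))) (+-identityˡ _)

  infix 4 _≋[_]_
  _≋[_]_ : Pow → ℕ → Pow → Set ℓ
  f ≋[ n ] g = ∀ i → i ℕ.≤ n → f i ≈ g i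

  ⊗-cong[] : ∀ {n f f′ g g′} → f ≋[ n ] f′ → g ≋[ n ] g′ → f ⊗ g ≋[ n ] f′ ⊗ g′
  ⊗-cong[] f≈ g≈ i i≤n = anti-cong i λ { j j′ ≡.refl → *-cong
    (f≈ j (ℕ.≤-trans (ℕ.m≤m+n j j′) i≤n)) (g≈ j′ (ℕ.≤-trans (ℕ.m≤n+m j′ j) i≤n)) }

  ^-cong[] : ∀ {n f f′} → f ≋[ n ] f′ → ∀ k → f ^ᴾ k ≋[ n ] f′ ^ᴾ k
  ^-cong[] f≈ zero    = λ _ _ → refl
  ^-cong[] f≈ (suc k) = ⊗-cong[] f≈ (^-cong[] f≈ k)

  -- The multinomial coefficient b! / ((b - ℓ)! m₁! m₂! ⋯), which is the coefficient of t^λ in T^b.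
  weight : ℕ → Partition → Carrier
  weight b ν = ⟦ b C ℓₚ ν ⟧ * ι (ℓ!/m ν)

  weight-falling : ∀ b ν → ⟦ multFactorial ν ⟧ * weight b ν ≈ ⟦ falling b (ℓₚ ν) ⟧
  weight-falling b ν = begin
    ⟦ multFactorial ν ⟧ * (⟦ b C ℓₚ ν ⟧ * ι (ℓ!/m ν))  ≈⟨ x∙yz≈y∙xz _ _ _ ⟩
    ⟦ b C ℓₚ ν ⟧ * (⟦ multFactorial ν ⟧ * ι (ℓ!/m ν))
      ≈⟨ *-congˡ (ι-/ (ℓₚ ν !) (multFactorial ν) {{multFactorial≢0 ν}}) ⟩
    ⟦ b C ℓₚ ν ⟧ * ⟦ ℓₚ ν ! ⟧                          ≈⟨ ⟦⟧-homo-* (b C ℓₚ ν) (ℓₚ ν !) ⟨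
    ⟦ (b C ℓₚ ν) ℕ.* ℓₚ ν ! ⟧                          ≡⟨ ≡.cong ⟦_⟧ (C*!≡falling b (ℓₚ ν)) ⟩
    ⟦ falling b (ℓₚ ν) ⟧                               ∎

  -- Of the b factors of a power, k supply the part p + 1 and the other b ∸ k supply the smaller
  -- parts. Multiplying by m_λ leaves falling factorials, whose additivity also covers k > b.
  weight-∷ : ∀ {p} b k (v : Vec ℕ p) →
    weight b (partitionOf (k ∷ v)) ≈ ⟦ b C k ⟧ * weight (b ∸ k) (partitionOf v)
  weight-∷ {p} b k v = ⟦⟧-cancel (multFactorial μ) {{multFactorial≢0 μ}} (begin
    ⟦ multFactorial μ ⟧ * weight b μ
      ≈⟨ weight-falling b μ ⟩
    ⟦ falling b (ℓₚ μ) ⟧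
      ≡⟨ ≡.cong (λ l → ⟦ falling b l ⟧) (≡.trans (List.length-++ (replicate k (suc p)))
           (≡.cong (ℕ._+ ℓₚ ν) (List.length-replicate k))) ⟩
    ⟦ falling b (k ℕ.+ ℓₚ ν) ⟧
      ≡⟨ ≡.cong ⟦_⟧ (≡.trans (falling-+ b k (ℓₚ ν))
           (≡.cong (ℕ._* falling (b ∸ k) (ℓₚ ν)) (≡.sym (C*!≡falling b k)))) ⟩
    ⟦ (b C k) ℕ.* k ! ℕ.* falling (b ∸ k) (ℓₚ ν) ⟧
      ≈⟨ trans (⟦⟧-homo-* ((b C k) ℕ.* k !) (falling (b ∸ k) (ℓₚ ν))) (*-cong (⟦⟧-homo-* (b C k) (k !))
           (sym (weight-falling (b ∸ k) ν))) ⟩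
    ⟦ b C k ⟧ * ⟦ k ! ⟧ * (⟦ multFactorial ν ⟧ * weight (b ∸ k) ν)
      ≈⟨ solve 4 (λ c f m w → c :* f :* (m :* w) := f :* m :* (c :* w)) refl _ _ _ _ ⟩
    ⟦ k ! ⟧ * ⟦ multFactorial ν ⟧ * (⟦ b C k ⟧ * weight (b ∸ k) ν)
      ≈⟨ *-congʳ (trans (⟦⟧-cong (multFactorial-∷ k v)) (⟦⟧-homo-* (k !) (multFactorial ν))) ⟨
    ⟦ multFactorial μ ⟧ * (⟦ b C k ⟧ * weight (b ∸ k) ν) ∎)
    where
    μ = partitionOf (k ∷ v)
    ν = partitionOf v

  -- Expansion of powers of T over partitions

  ∏-replicate : ∀ (f : ℕ → Carrier) k x → ∏ (replicate k x) f ≈ f x ^ k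
  ∏-replicate f zero    x = refl
  ∏-replicate f (suc k) x = *-congˡ (∏-replicate f k x)

  sum-replicate : ∀ k x → sum (replicate k x) ≡ k ℕ.* x
  sum-replicate zero    x = ≡.refl
  sum-replicate (suc k) x = ≡.cong (x ℕ.+_) (sum-replicate k x)

  sumᴾ-upTo : ∀ n (F : ℕ → Pow) i → sumᴾ {n} (λ k → F (toℕ k)) i ≈ ∑ (upTo n) (λ k → F k i)
  sumᴾ-upTo n F i = go n id
    where
    go : ∀ n (g : ℕ → ℕ) → sumᴾ {n} (λ k → F (g (toℕ k))) i ≈ ∑ (applyUpTo g n) (λ k → F k i)
    go zero    g = refl
    go (suc n) g = +-congˡ (go n (g ∘ suc))

  ∑-upTo-extend : ∀ {m n} → m ℕ.≤ n → ∀ (f : ℕ → Carrier) → (∀ k → m ℕ.≤ k → f k ≈ 0#) →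
                  ∑ (upTo m) f ≈ ∑ (upTo n) f
  ∑-upTo-extend {m} {n} m≤n f f≈0 = go m≤n id λ k m≤k → f≈0 k m≤k
    where
    go : ∀ {m n} → m ℕ.≤ n → (g : ℕ → ℕ) → (∀ k → m ℕ.≤ k → f (g k) ≈ 0#) →
         ∑ (applyUpTo g m) f ≈ ∑ (applyUpTo g n) f
    go {n = zero}  ℕ.z≤n       g f≈0 = refl
    go {n = suc n} ℕ.z≤n       g f≈0 = sym (trans
      (+-cong (f≈0 0 ℕ.z≤n) (sym (go {n = n} ℕ.z≤n (g ∘ suc) λ k _ → f≈0 (suc k) ℕ.z≤n))) (+-identityˡ 0#))
    go             (ℕ.s≤s m≤n) g f≈0 = +-congˡ (go m≤n (g ∘ suc) λ k m≤k → f≈0 (suc k) (ℕ.s≤s m≤k))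

  1^ : ∀ b → P.1# ^ᴾ b ≋ P.1#
  1^ zero    = P.refl
  1^ (suc b) = P.trans (P.*-identityˡ _) (1^ b)

  summand : ℕ → Partition → Pow
  summand b ν i = weight b ν * ∏ (parts ν) T * mono ∣ ν ∣ₚ i

  -- In the binomial expansion, k counts the parts equal to p + 1 and the rest is a power b ∸ k of
  -- the shorter polynomial. Hence the induction on p keeps b free below the fixed bound M.
  truncated-^ : ∀ M p b → b ℕ.≤ M →
    truncated p ^ᴾ b ≋ (λ i → ∑ (boxed M p) (λ v → summand b (partitionOf v) i))
  truncated-^ M zero b b≤M i = begin
    (P.1# ^ᴾ b) i
      ≈⟨ 1^ b i ⟩
    mono 0 i
      ≈⟨ *-identityˡ _ ⟨
    1# * mono 0 i
      ≈⟨ *-congʳ (trans (*-identityʳ _) (trans (*-cong (trans (⟦⟧-cong (nC0≡1 b)) ⟦1⟧)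
           (trans (ι-fromℕ 1) ⟦1⟧)) (*-identityˡ 1#))) ⟨
    summand b (partitionOf []) i
      ≈⟨ +-identityʳ _ ⟨
    ∑ (boxed M 0) (λ v → summand b (partitionOf v) i) ∎
  truncated-^ M (suc p) b b≤M i = begin
    (truncated (suc p) ^ᴾ b) i
      ≈⟨ Binomial.theorem b x (truncated p) i ⟩
    sumᴾ {suc b} (λ k → term (toℕ k)) i
      ≈⟨ sumᴾ-upTo (suc b) term i ⟩
    ∑ (upTo (suc b)) (λ k → term k i)
      -- The terms with b < k ≤ M vanish with C(b, k); adding them lets all exponents share one box.
      ≈⟨ ∑-upTo-extend (ℕ.s≤s b≤M) (λ k → term k i) (λ k b<k → trans (×ᴾ-coeff (b C k) _ i)
           (trans (*-congʳ (⟦⟧-cong (k>n⇒nCk≡0 b<k))) (zeroˡ _))) ⟩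
    ∑ (upTo (suc M)) (λ k → term k i)
      ≈⟨ ∑-cong (upTo (suc M)) step ⟩
    ∑ (upTo (suc M)) (λ k → ∑ (boxed M p) (λ v → summand b (partitionOf (k ∷ v)) i))
      ≈⟨ ∑-cartesianProductWith _∷_ (λ v → summand b (partitionOf v) i) (upTo (suc M)) (boxed M p) ⟨
    ∑ (boxed M (suc p)) (λ v → summand b (partitionOf v) i) ∎
    where
    τ = t (suc p)
    x = const τ ⊗ mono (suc p)
    z = truncated p
    term : ℕ → Pow
    term k = (b C k) ×ᴾ (x ^ᴾ k ⊗ z ^ᴾ (b ∸ k))

    x^ : ∀ k → x ^ᴾ k ≋ const (τ ^ k) ⊗ mono (k ℕ.* suc p)
    x^ k = P.trans (^ᴾ-distrib-* (const τ) (mono (suc p)) k) (P.*-cong (const-^ τ k) (mono-^ (suc p) k))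

    size : ∀ k (v : Vec ℕ p) → k ℕ.* suc p ℕ.+ sum (partsOf v) ≡ sum (partsOf (k ∷ v))
    size k v = ≡.sym (≡.trans (ListAction.sum-++ (replicate k (suc p)) (partsOf v))
      (≡.cong (ℕ._+ sum (partsOf v)) (sum-replicate k (suc p))))

    monomial : ∀ k (v : Vec ℕ p) → ∏ (partsOf (k ∷ v)) T ≈ τ ^ k * ∏ (partsOf v) T
    monomial k v = trans (∏-++ T (replicate k (suc p)) (partsOf v)) (*-congʳ (∏-replicate T k (suc p)))

    step : ∀ k → term k i ≈ ∑ (boxed M p) (λ v → summand b (partitionOf (k ∷ v)) i)
    step k = begin
      term k i
        ≈⟨ ×ᴾ-coeff (b C k) _ i ⟩
      ⟦ b C k ⟧ * (x ^ᴾ k ⊗ z ^ᴾ (b ∸ k)) i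
        ≈⟨ *-congˡ (P.trans (P.*-congʳ (x^ k)) (P.*-assoc (const (τ ^ k)) (mono (k ℕ.* suc p)) (z ^ᴾ (b ∸ k))) i) ⟩
      ⟦ b C k ⟧ * (const (τ ^ k) ⊗ (mono (k ℕ.* suc p) ⊗ z ^ᴾ (b ∸ k))) i
        ≈⟨ *-congˡ (const-⊗ (τ ^ k) _ i) ⟩
      ⟦ b C k ⟧ * (τ ^ k * (mono (k ℕ.* suc p) ⊗ z ^ᴾ (b ∸ k)) i)
        ≈⟨ *-congˡ (*-congˡ (trans
             (P.*-congˡ {mono (k ℕ.* suc p)} (truncated-^ M p (b ∸ k) (ℕ.≤-trans (ℕ.m∸n≤m b k) b≤M)) i)
             (⊗-∑ (mono (k ℕ.* suc p)) (λ v → weight (b ∸ k) (partitionOf v) * ∏ (partsOf v) T)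
               (λ v → mono (sum (partsOf v))) (boxed M p) i))) ⟩
      ⟦ b C k ⟧ * (τ ^ k * ∑ (boxed M p) (λ v → weight (b ∸ k) (partitionOf v) * ∏ (partsOf v) T *
                                             (mono (k ℕ.* suc p) ⊗ mono (sum (partsOf v))) i))
        ≈⟨ trans (*-congˡ (*-∑ (τ ^ k) _ (boxed M p))) (*-∑ _ _ (boxed M p)) ⟩
      ∑ (boxed M p) (λ v → ⟦ b C k ⟧ * (τ ^ k * (weight (b ∸ k) (partitionOf v) * ∏ (partsOf v) T *
                                             (mono (k ℕ.* suc p) ⊗ mono (sum (partsOf v))) i)))
        ≈⟨ ∑-cong (boxed M p) (λ v → trans
             (solve 5 (λ c τ w π m → c :* (τ :* (w :* π :* m)) := c :* w :* (τ :* π) :* m) refl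
               ⟦ b C k ⟧ (τ ^ k) (weight (b ∸ k) (partitionOf v)) (∏ (partsOf v) T) _)
             (*-cong (sym (*-cong (weight-∷ b k v) (monomial k v)))
               (trans (mono-⊗-mono (k ℕ.* suc p) (sum (partsOf v)) i)
                 (reflexive (≡.cong (λ s → mono s i) (size k v)))))) ⟩
      ∑ (boxed M p) (λ v → summand b (partitionOf (k ∷ v)) i) ∎

  module Coefficients (n M : ℕ) where

    -- The coefficient at n sees f only up to degree n, where f is a finite sum of monomials. The
    -- coefficients y stay abstract to serve both T^b and D (T^b).
    ⊗-monomials : ∀ f g (y : Partition → Carrier) →
      f ≋[ n ] (λ i → ∑ (boxed M n) (λ v → y (partitionOf v) * mono ∣ partitionOf v ∣ₚ i)) →
      (f ⊗ g) n ≈ ∑ (partitions M n) (λ ν → y ν * (mono ∣ ν ∣ₚ ⊗ g) n)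
    ⊗-monomials f g y f≈ = begin
      (f ⊗ g) n
        ≈⟨ ⊗-cong[] f≈ (λ _ _ → refl) n ℕ.≤-refl ⟩
      ((λ i → ∑ (boxed M n) (λ v → y (partitionOf v) * mono ∣ partitionOf v ∣ₚ i)) ⊗ g) n
        ≈⟨ trans (P.*-comm _ g n) (⊗-∑ g (y ∘ partitionOf) (λ v → mono ∣ partitionOf v ∣ₚ) (boxed M n) n) ⟩
      ∑ (boxed M n) (λ v → y (partitionOf v) * (g ⊗ mono ∣ partitionOf v ∣ₚ) n)
        ≈⟨ ∑-cong (boxed M n) (λ v → *-congˡ (P.*-comm g (mono ∣ partitionOf v ∣ₚ) n)) ⟩
      ∑ (boxed M n) (λ v → y (partitionOf v) * (mono ∣ partitionOf v ∣ₚ ⊗ g) n)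
        ≡⟨ ∑-map partitionOf (λ ν → y ν * (mono ∣ ν ∣ₚ ⊗ g) n) (boxed M n) ⟨
      ∑ (partitions M n) (λ ν → y ν * (mono ∣ ν ∣ₚ ⊗ g) n) ∎

    T-^ : ∀ b → b ℕ.≤ M →
      T ^ᴾ b ≋[ n ] (λ i → ∑ (boxed M n) (λ v → weight b (partitionOf v) * t^ (partitionOf v) *
                                              mono ∣ partitionOf v ∣ₚ i))
    T-^ b b≤M i i≤n = trans (^-cong[] (λ j j≤n → sym (truncated-≤ j≤n)) b i i≤n)
      (trans (truncated-^ M n b b≤M i)
        (∑-cong (boxed M n) λ v → *-congʳ (*-congˡ (sym (t^-parts (partitionOf v))))))

    T-^-⊗ : ∀ b g → b ℕ.≤ M → (T ^ᴾ b ⊗ g) n ≈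
      ∑ (partitions M n) (λ ν → weight b ν * t^ ν * (mono ∣ ν ∣ₚ ⊗ g) n)
    T-^-⊗ b g b≤M = ⊗-monomials (T ^ᴾ b) g _ (T-^ b b≤M)

    -- D multiplies the monomial of degree |λ| by |λ|: the origin of this factor in the formulas for
    -- A and AB.
    D-T-^-⊗ : ∀ b g → b ℕ.≤ M → (D (T ^ᴾ b) ⊗ g) n ≈
      ∑ (partitions M n) (λ ν → ⟦ ∣ ν ∣ₚ ⟧ * (weight b ν * t^ ν) * (mono ∣ ν ∣ₚ ⊗ g) n)
    D-T-^-⊗ b g b≤M = ⊗-monomials (D (T ^ᴾ b)) g _ λ i i≤n →
      trans (*-congˡ (T-^ b b≤M i i≤n)) (trans (*-∑ ⟦ i ⟧ _ (boxed M n))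
        (∑-cong (boxed M n) λ v → trans (x∙yz≈y∙xz _ _ _)
          (trans (*-congˡ (D-mono ∣ partitionOf v ∣ₚ i))
            (trans (x∙yz≈y∙xz _ _ _) (sym (*-assoc _ _ _))))))

  ∑-distrib-+ : ∀ {X : Set} (f g : X → Carrier) xs → ∑ xs (λ x → f x + g x) ≈ ∑ xs f + ∑ xs g
  ∑-distrib-+ f g []       = sym (+-identityˡ 0#)
  ∑-distrib-+ f g (x ∷ xs) = trans (+-congˡ (∑-distrib-+ f g xs)) (+-interchange _ _ _ _)

  -- The three coefficient formulas

  module Theorem (k : ℕ) (1≤k : 1 ℕ.≤ k) where

    open ValidTrees k 1≤k
    cancel : ∀ n {x y} → ⟦ suc n ⟧ * x ≈ ⟦ suc n ⟧ * y → x ≈ y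
    cancel n = ⟦⟧-cancel (suc n)
    open Lagrange φ cancel using (c; ⊗-c; lagrange-D)

    φ-^ : ∀ n → φ ^ᴾ n ≋ T ^ᴾ (k ℕ.* n) ⊗ β ^ᴾ n
    φ-^ n = P.trans (^ᴾ-distrib-* (T ^ᴾ k) β n) (P.*-congʳ (^ᴾ-assocʳ T k n))

    -- The power rule for T, with a spectator g. At N = kn it is the origin of the denominator kn +
    -- 1.
    D-T-power : ∀ N g n → ⟦ suc N ⟧ * (D T ⊗ (T ^ᴾ N ⊗ g)) n ≈ (D (T ^ᴾ suc N) ⊗ g) n
    D-T-power N g n = begin
      ⟦ suc N ⟧ * (D T ⊗ (T ^ᴾ N ⊗ g)) n   ≈⟨ *-congˡ (P.*-assoc (D T) (T ^ᴾ N) g n) ⟨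
      ⟦ suc N ⟧ * ((D T ⊗ T ^ᴾ N) ⊗ g) n   ≈⟨ ×ᴾ-coeff (suc N) ((D T ⊗ T ^ᴾ N) ⊗ g) n ⟨
      (suc N ×ᴾ ((D T ⊗ T ^ᴾ N) ⊗ g)) n    ≈⟨ ×ᴾ-assoc-* (suc N) (D T ⊗ T ^ᴾ N) g n ⟨
      (suc N ×ᴾ (D T ⊗ T ^ᴾ N) ⊗ g) n      ≈⟨ P.*-congʳ {g} (D-^ T N) n ⟨
      (D (T ^ᴾ suc N) ⊗ g) n               ∎

    0-term : ∀ (F : Pow) → F 0 ≈ 1# → anti (λ m q → F m * c m q) 0 ≈ 1#
    0-term F F0≈1 = trans (*-identityʳ _) F0≈1

    A-0 : A k 0 ≈ 1#
    A-0 = trans (A-lagrange cancel 0) (0-term T refl)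

    B-0 : B k 0 ≈ 1#
    B-0 = trans (B-lagrange cancel 0) (0-term β refl)

    AB-0 : (A k ⊛ B k) 0 ≈ 1#
    AB-0 = trans (+-identityʳ _) (trans (*-cong A-0 B-0) (*-identityˡ 1#))

    module _ (n : ℕ) .{{_ : NonZero n}} where

      -- Three roles at once: the denominator kn + 1, the highest power of T to be expanded, and the
      -- bound on multiplicities in the box. For the last one `n≤N` matters, since a partition of
      -- size at most n has at most n parts.
      N = suc (k ℕ.* n)
      1/n = ι (pos 1 /ℚ n)
      1/N = ι (pos 1 /ℚ N)
      open Coefficients n N

      n≤N : n ℕ.≤ N
      n≤N = ℕ.m≤n⇒m≤1+n (ℕ.m≤n*m n k {{ℕ.>-nonZero 1≤k}})

      -- For |λ| > n each of C(n, |λ|), C(n, |λ| + 1) and C(n + 1, |λ| + 1) is zero, so every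
      -- coefficient vanishes off the support.
      outside-support : ∀ {ν} → ν ∉ partitions N n → n ℕ.< ∣ ν ∣ₚ
      outside-support {ν} ν∉ = ℕ.≰⇒> λ |ν|≤n → ν∉ (partitions-complete n≤N ν |ν|≤n)

      C-0 : ∀ {a b} → a ℕ.< b → ⟦ a C b ⟧ ≈ 0#
      C-0 a<b = ⟦⟧-cong (k>n⇒nCk≡0 a<b)

      ι-coeffA : ∀ ν → ι (coeffA k n ν) ≈ 1/n * (1/N * ⟦ ∣ ν ∣ₚ ⟧) * ⟦ n C ∣ ν ∣ₚ ⟧ * weight N ν
      ι-coeffA ν = trans (trans (*-homo _ _) (*-congʳ (trans (*-homo _ _) (*-cong
          (trans (*-homo _ _) (*-cong (trans (*-homo _ _) (*-congˡ (ι-/-split ∣ ν ∣ₚ N))) (ι-fromℕ (n C ∣ ν ∣ₚ))))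
          (ι-fromℕ (N C ℓₚ ν))))))
        (*-assoc _ _ _)

      ι-coeffB : ∀ ν → ι (coeffB k n ν) ≈ 1/n * ⟦ n C (∣ ν ∣ₚ ℕ.+ 1) ⟧ * weight (k ℕ.* n) ν
      ι-coeffB ν = trans (trans (*-homo _ _) (*-congʳ (trans (*-homo _ _) (*-cong
          (trans (*-homo _ _) (*-congˡ (ι-fromℕ (n C (∣ ν ∣ₚ ℕ.+ 1)))))
          (ι-fromℕ ((k ℕ.* n) C ℓₚ ν))))))
        (*-assoc _ _ _)

      ι-coeffAB : ∀ ν → ι (coeffAB k n ν) ≈
        1/n * (⟦ n C (∣ ν ∣ₚ ℕ.+ 1) ⟧ + 1/N * ⟦ ∣ ν ∣ₚ ⟧ * ⟦ (n ℕ.+ 1) C (∣ ν ∣ₚ ℕ.+ 1) ⟧) * weight N ν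
      ι-coeffAB ν = trans (trans (*-homo _ _) (*-congʳ (trans (*-homo _ _) (*-cong
          (trans (*-homo _ _) (*-congˡ (trans (+-homo _ _) (+-cong (ι-fromℕ (n C (∣ ν ∣ₚ ℕ.+ 1)))
            (trans (*-homo _ _) (*-cong (ι-/-split ∣ ν ∣ₚ N) (ι-fromℕ ((n ℕ.+ 1) C (∣ ν ∣ₚ ℕ.+ 1)))))))))
          (ι-fromℕ (N C ℓₚ ν))))))
        (*-assoc _ _ _)

      mono-⊗-mono1-⊗-β^ : ∀ q → (mono q ⊗ (mono 1 ⊗ β ^ᴾ n)) n ≈ ⟦ n C (q ℕ.+ 1) ⟧
      mono-⊗-mono1-⊗-β^ q = trans (P.sym (P.*-assoc (mono q) (mono 1) (β ^ᴾ n)) n)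
        (trans (P.*-congʳ {β ^ᴾ n} (mono-⊗-mono q 1) n) (mono-⊗-β^ 0 (q ℕ.+ 1) n))

      A-coefficient : IsSumOverPartitions (λ ν → ι (coeffA k n ν) * t^ ν) (A k n)
      A-coefficient = record
        { support  = partitions N n
        ; distinct = partitions-unique N n
        ; outside  = λ {ν} ν∉ → trans (*-congʳ (trans (ι-coeffA ν) (trans
            (*-congʳ (trans (*-congˡ (C-0 (outside-support ν∉))) (zeroʳ _))) (zeroˡ _)))) (zeroˡ _)
        ; total = begin
            A k n
              ≈⟨ A-lagrange cancel n ⟩
            anti (λ m q → T m * c m q) n
              ≈⟨ ÷-intro n (trans (lagrange-D T n) (P.*-congˡ {D T} (φ-^ n) n)) ⟩
            1/n * (D T ⊗ (T ^ᴾ (k ℕ.* n) ⊗ β ^ᴾ n)) n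
              ≈⟨ *-congˡ (÷-intro N (D-T-power (k ℕ.* n) (β ^ᴾ n) n)) ⟩
            1/n * (1/N * (D (T ^ᴾ N) ⊗ β ^ᴾ n) n)
              ≈⟨ *-congˡ (*-congˡ (D-T-^-⊗ N (β ^ᴾ n) ℕ.≤-refl)) ⟩
            1/n * (1/N * ∑ (partitions N n) (λ ν → ⟦ ∣ ν ∣ₚ ⟧ * (weight N ν * t^ ν) * (mono ∣ ν ∣ₚ ⊗ β ^ᴾ n) n))
              ≈⟨ trans (*-congˡ (*-∑ 1/N _ (partitions N n))) (*-∑ 1/n _ (partitions N n)) ⟩
            ∑ (partitions N n) (λ ν → 1/n * (1/N * (⟦ ∣ ν ∣ₚ ⟧ * (weight N ν * t^ ν) * (mono ∣ ν ∣ₚ ⊗ β ^ᴾ n) n)))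
              ≈⟨ ∑-cong (partitions N n) (λ ν → trans
                   (*-congˡ (*-congˡ (*-congˡ (mono-⊗-β^ 0 ∣ ν ∣ₚ n))))
                   (trans (solve 6 (λ i j q w τ b → i :* (j :* (q :* (w :* τ) :* b)) := i :* (j :* q) :* b :* w :* τ)
                     refl 1/n 1/N ⟦ ∣ ν ∣ₚ ⟧ (weight N ν) (t^ ν) ⟦ n C ∣ ν ∣ₚ ⟧)
                     (*-congʳ (sym (ι-coeffA ν))))) ⟩
            ∑ (partitions N n) (λ ν → ι (coeffA k n ν) * t^ ν) ∎ }

      B-coefficient : IsSumOverPartitions (λ ν → ι (coeffB k n ν) * t^ ν) (B k n)
      B-coefficient = record
        { support  = partitions N n
        ; distinct = partitions-unique N n
        ; outside  = λ {ν} ν∉ → trans (*-congʳ (trans (ι-coeffB ν) (trans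
            (*-congʳ (trans (*-congˡ (C-0 (ℕ.≤-trans (outside-support ν∉) (ℕ.m≤m+n ∣ ν ∣ₚ 1)))) (zeroʳ _)))
            (zeroˡ _)))) (zeroˡ _)
        ; total = begin
            B k n
              ≈⟨ B-lagrange cancel n ⟩
            anti (λ m q → β m * c m q) n
              -- Here D β = y, so T keeps the exponent kn and no factor |λ| arises; the extra y
              -- shifts the lower index to |λ| + 1.
              ≈⟨ ÷-intro n (trans (lagrange-D β n) (trans (P.*-cong D-β (φ-^ n) n)
                   (P-x∙yz≈y∙xz (mono 1) (T ^ᴾ (k ℕ.* n)) (β ^ᴾ n) n))) ⟩
            1/n * (T ^ᴾ (k ℕ.* n) ⊗ (mono 1 ⊗ β ^ᴾ n)) n
              ≈⟨ *-congˡ (T-^-⊗ (k ℕ.* n) (mono 1 ⊗ β ^ᴾ n) (ℕ.n≤1+n (k ℕ.* n))) ⟩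
            1/n * ∑ (partitions N n) (λ ν → weight (k ℕ.* n) ν * t^ ν * (mono ∣ ν ∣ₚ ⊗ (mono 1 ⊗ β ^ᴾ n)) n)
              ≈⟨ *-∑ 1/n _ (partitions N n) ⟩
            ∑ (partitions N n) (λ ν → 1/n * (weight (k ℕ.* n) ν * t^ ν * (mono ∣ ν ∣ₚ ⊗ (mono 1 ⊗ β ^ᴾ n)) n))
              ≈⟨ ∑-cong (partitions N n) (λ ν → trans
                   (*-congˡ (*-congˡ (mono-⊗-mono1-⊗-β^ ∣ ν ∣ₚ)))
                   (trans (solve 4 (λ i w τ b → i :* (w :* τ :* b) := i :* b :* w :* τ)
                     refl 1/n (weight (k ℕ.* n) ν) (t^ ν) ⟦ n C (∣ ν ∣ₚ ℕ.+ 1) ⟧)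
                     (*-congʳ (sym (ι-coeffB ν))))) ⟩
            ∑ (partitions N n) (λ ν → ι (coeffB k n ν) * t^ ν) ∎ }

      AB-coefficient : IsSumOverPartitions (λ ν → ι (coeffAB k n ν) * t^ ν) ((A k ⊛ B k) n)
      AB-coefficient = record
        { support  = partitions N n
        ; distinct = partitions-unique N n
        ; outside  = λ {ν} ν∉ → trans (*-congʳ (trans (ι-coeffAB ν) (trans
            (*-congʳ (trans (*-congˡ (trans (+-cong
              (C-0 (ℕ.≤-trans (outside-support ν∉) (ℕ.m≤m+n ∣ ν ∣ₚ 1)))
              (trans (*-congˡ (C-0 (ℕ.+-monoˡ-< 1 (outside-support ν∉)))) (zeroʳ _)))
              (+-identityˡ 0#))) (zeroʳ _)))
            (zeroˡ _)))) (zeroˡ _)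
        ; total = begin
            (A k ⊛ B k) n
              ≈⟨ ∑-upTo n (λ i j → A k i * B k j) ⟩
            (A k ⊗ B k) n
              ≈⟨ P.*-cong (A-lagrange cancel) (B-lagrange cancel) n ⟩
            anti (λ i j → anti (λ m q → T m * c m q) i * anti (λ m q → β m * c m q) j) n
              ≈⟨ ⊗-c T β n ⟩
            anti (λ m q → (T ⊗ β) m * c m q) n
              -- The Leibniz rule yields the two summands of the formula. In the first, β joins βⁿ
              -- and gives C(n + 1, |λ| + 1), while D T raises T to the power kn + 1 at the cost of
              -- |λ|/(kn + 1). In the second, T joins T^(kn) and D β = y gives C(n, |λ| + 1). Both
              -- contain `weight N`, which is then factored out.
              ≈⟨ ÷-intro n (trans (lagrange-D (T ⊗ β) n) (trans (P.*-cong (D-⊗ T β) (φ-^ n) n)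
                   (P.distribʳ (T ^ᴾ (k ℕ.* n) ⊗ β ^ᴾ n) (D T ⊗ β) (T ⊗ D β) n))) ⟩
            1/n * ((D T ⊗ β ⊗ (T ^ᴾ (k ℕ.* n) ⊗ β ^ᴾ n)) n + (T ⊗ D β ⊗ (T ^ᴾ (k ℕ.* n) ⊗ β ^ᴾ n)) n)
              ≈⟨ *-congˡ (+-cong
                   (trans (regroup (D T) β n)
                     (trans (÷-intro N (D-T-power (k ℕ.* n) (β ^ᴾ suc n) n))
                       (*-congˡ (D-T-^-⊗ N (β ^ᴾ suc n) ℕ.≤-refl))))
                   (trans (P-interchange T (D β) (T ^ᴾ (k ℕ.* n)) (β ^ᴾ n) n)
                     (trans (P.*-congˡ {T ^ᴾ N} (P.*-congʳ {β ^ᴾ n} D-β) n)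
                       (T-^-⊗ N (mono 1 ⊗ β ^ᴾ n) ℕ.≤-refl)))) ⟩
            1/n * (1/N * ∑ (partitions N n) (λ ν → ⟦ ∣ ν ∣ₚ ⟧ * (weight N ν * t^ ν) * (mono ∣ ν ∣ₚ ⊗ β ^ᴾ suc n) n) +
                   ∑ (partitions N n) (λ ν → weight N ν * t^ ν * (mono ∣ ν ∣ₚ ⊗ (mono 1 ⊗ β ^ᴾ n)) n))
              ≈⟨ trans (*-congˡ (trans (+-congʳ (*-∑ 1/N _ (partitions N n))) (sym (∑-distrib-+ _ _ (partitions N n)))))
                   (*-∑ 1/n _ (partitions N n)) ⟩
            ∑ (partitions N n) (λ ν → 1/n *
              (1/N * (⟦ ∣ ν ∣ₚ ⟧ * (weight N ν * t^ ν) * (mono ∣ ν ∣ₚ ⊗ β ^ᴾ suc n) n) +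
               weight N ν * t^ ν * (mono ∣ ν ∣ₚ ⊗ (mono 1 ⊗ β ^ᴾ n)) n))
              ≈⟨ ∑-cong (partitions N n) (λ ν → trans
                   (*-congˡ (+-cong (*-congˡ (*-congˡ (trans (mono-⊗-β^ 1 ∣ ν ∣ₚ n)
                       (⟦⟧-cong (≡.cong₂ _C_ (ℕ.+-comm 1 n) (ℕ.+-comm 1 ∣ ν ∣ₚ))))))
                     (*-congˡ (mono-⊗-mono1-⊗-β^ ∣ ν ∣ₚ))))
                   (trans (solve 7 (λ i j q w τ b b′ → i :* (j :* (q :* (w :* τ) :* b′) :+ w :* τ :* b) :=
                                                     i :* (b :+ j :* q :* b′) :* w :* τ)
                     refl 1/n 1/N ⟦ ∣ ν ∣ₚ ⟧ (weight N ν) (t^ ν)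
                     ⟦ n C (∣ ν ∣ₚ ℕ.+ 1) ⟧ ⟦ (n ℕ.+ 1) C (∣ ν ∣ₚ ℕ.+ 1) ⟧)
                     (*-congʳ (sym (ι-coeffAB ν))))) ⟩
            ∑ (partitions N n) (λ ν → ι (coeffAB k n ν) * t^ ν) ∎ }
        where
        regroup : ∀ f g → f ⊗ g ⊗ (T ^ᴾ (k ℕ.* n) ⊗ g ^ᴾ n) ≋ f ⊗ (T ^ᴾ (k ℕ.* n) ⊗ g ^ᴾ suc n)
        regroup f g = P.trans (P.*-assoc f g _) (P.*-congˡ {f} (P-x∙yz≈y∙xz g (T ^ᴾ (k ℕ.* n)) (g ^ᴾ n)))

mainTheorem3 : ∀ {c ℓ} (K : CommutativeRing c ℓ) (ι : ℚ → CommutativeRing.Carrier K) →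
    RingMorphisms.IsRingHomomorphism +-*-rawRing (CommutativeRing.rawRing K) ι →
    (t : ℕ → CommutativeRing.Carrier K) (k : ℕ) → 1 ≤ k →
    let open GeneratingFunctions K ι t in
    (A k ≈1+∑ coeffA k) × (B k ≈1+∑ coeffB k) × ((A k ⊛ B k) ≈1+∑ coeffAB k)
mainTheorem3 K ι hom t k 1≤k =
  (A-0 , λ n → A-coefficient n) , (B-0 , λ n → B-coefficient n) , (AB-0 , λ n → AB-coefficient n)
  where open Expansion.Theorem K ι hom t k 1≤k
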